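{- Let $J(x,y,w)=\sum_{n\ge1}\sum_{\sigma\in S_n(T_1)}x^ny^{pos(\sigma)}w^{lmax(\sigma)}$ and $B(x,y,w)=\sum_{n\ge1}\sum_{\sigma\in S_n(T_1),\,\sigma(n)=n}x^ny^{pos(\sigma)}w^{lmax(\sigma)}$. Then $$J(x,y,w)=\frac{B(x,y,w)\bigl(B(x,y,w)-yw\bigr)}{2B(x,y,w)-yw}.$$
   Context: A permutation $\sigma$ avoids $\tau$ if no subsequence of $\sigma$ has the same relative order as $\tau$. $T_1=\{3214,3241,4213,4231\}$ and $S_n(T_1)$ is the set of permutations in $S_n$ avoiding all four patterns. $pos(\sigma)$ is the position of the maximum entry of $\sigma$, and $lmax(\sigma)$ is the number of left-to-right maxima of $\sigma$ (entries larger than all preceding entries). Generating functions are formal power series. -}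

module Defs where

open import Data.Nat using (ℕ; zero; suc; _+_; _∸_; _<ᵇ_; _≡ᵇ_; _⊔_)
open import Data.Bool using (Bool; true; false; _∧_; _∨_; not; if_then_else_)
open import Data.List using (List; []; _∷_; _++_; map; concatMap; upTo; length; zip; foldr)
open import Data.Bool.ListAction using (all; any)
open import Data.Product using (_,_)
open import Data.Integer as ℤ using (ℤ; +_)

-- Permutations of {1,…,n} in one-line notation, as lists of naturals.

words : ℕ → ℕ → List (List ℕ)
words n zero    = [] ∷ []
words n (suc k) = concatMap (λ w → map (λ a → a ∷ w) (map suc (upTo n))) (words n k)

elemᵇ : ℕ → List ℕ → Bool
elemᵇ x []       = false
elemᵇ x (y ∷ ys) = (x ≡ᵇ y) ∨ elemᵇ x ys

distinctᵇ : List ℕ → Bool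
distinctᵇ []       = true
distinctᵇ (x ∷ xs) = not (elemᵇ x xs) ∧ distinctᵇ xs

filterᵇ : {A : Set} → (A → Bool) → List A → List A
filterᵇ p []       = []
filterᵇ p (x ∷ xs) = if p x then x ∷ filterᵇ p xs else filterᵇ p xs

countᵇ : {A : Set} → (A → Bool) → List A → ℕ
countᵇ p xs = length (filterᵇ p xs)

perms : ℕ → List (List ℕ)
perms n = filterᵇ distinctᵇ (words n n)

subseqs : List ℕ → List (List ℕ)
subseqs []       = [] ∷ []
subseqs (x ∷ xs) = map (x ∷_) (subseqs xs) ++ subseqs xs

sameOrderᵇ : List ℕ → List ℕ → Bool
sameOrderᵇ []      []      = true
sameOrderᵇ (a ∷ s) (b ∷ t) =
  all (λ { (x , y) → eqB (a <ᵇ x) (b <ᵇ y) ∧ eqB (x <ᵇ a) (y <ᵇ b) }) (zip s t)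
  ∧ sameOrderᵇ s t
  where
  eqB : Bool → Bool → Bool
  eqB true  true  = true
  eqB false false = true
  eqB _     _     = false
sameOrderᵇ _ _ = false

containsᵇ : List ℕ → List ℕ → Bool
containsᵇ σ τ = any (λ s → sameOrderᵇ s τ) (subseqs σ)

T₁ : List (List ℕ)
T₁ = (3 ∷ 2 ∷ 1 ∷ 4 ∷ []) ∷ (3 ∷ 2 ∷ 4 ∷ 1 ∷ []) ∷ (4 ∷ 2 ∷ 1 ∷ 3 ∷ [])
   ∷ (4 ∷ 2 ∷ 3 ∷ 1 ∷ []) ∷ []

avoidsT₁ᵇ : List ℕ → Bool
avoidsT₁ᵇ σ = not (any (containsᵇ σ) T₁)

maxL : List ℕ → ℕ
maxL = foldr _⊔_ 0

-- 1-based index of the first occurrence of m (length+1 if absent)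
indexOf : ℕ → List ℕ → ℕ
indexOf m []       = 1
indexOf m (x ∷ xs) = if m ≡ᵇ x then 1 else suc (indexOf m xs)

pos : List ℕ → ℕ
pos σ = indexOf (maxL σ) σ

-- number of left-to-right maxima (entries are ≥ 1, so start with 0)
lmaxFrom : ℕ → List ℕ → ℕ
lmaxFrom m []       = 0
lmaxFrom m (x ∷ xs) = if m <ᵇ x then suc (lmaxFrom x xs) else lmaxFrom m xs

lmax : List ℕ → ℕ
lmax = lmaxFrom 0

lastIsᵇ : ℕ → List ℕ → Bool
lastIsᵇ n []           = false
lastIsᵇ n (x ∷ [])     = n ≡ᵇ x
lastIsᵇ n (x ∷ y ∷ xs) = lastIsᵇ n (y ∷ xs)

-- Formal power series in x, y, w with integer coefficients:
-- F n p l is the coefficient of x^n y^p w^l.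

FPS3 : Set
FPS3 = ℕ → ℕ → ℕ → ℤ

sumTo : ℕ → (ℕ → ℤ) → ℤ
sumTo zero    f = f 0
sumTo (suc n) f = sumTo n f ℤ.+ f (suc n)

_⊕_ : FPS3 → FPS3 → FPS3
(F ⊕ G) n p l = F n p l ℤ.+ G n p l

_⊖_ : FPS3 → FPS3 → FPS3
(F ⊖ G) n p l = F n p l ℤ.- G n p l

_⊛_ : FPS3 → FPS3 → FPS3
(F ⊛ G) n p l =
  sumTo n (λ a → sumTo p (λ b → sumTo l (λ c →
    F a b c ℤ.* G (n ∸ a) (p ∸ b) (l ∸ c))))

yw : FPS3
yw zero (suc zero) (suc zero) = + 1
yw _    _          _          = + 0

J : FPS3
J zero    p l = + 0
J (suc m) p l = + countᵇ (λ σ → avoidsT₁ᵇ σ ∧ (pos σ ≡ᵇ p) ∧ (lmax σ ≡ᵇ l)) (perms (suc m))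

B : FPS3
B zero    p l = + 0
B (suc m) p l = + countᵇ (λ σ → avoidsT₁ᵇ σ ∧ lastIsᵇ (suc m) σ ∧ (pos σ ≡ᵇ p) ∧ (lmax σ ≡ᵇ l))
                         (perms (suc m))

{-# OPTIONS --safe #-}
module Submission where

-- An entry b of σ plays the role of the 2 in a pattern of T₁ exactly when something larger
-- precedes it and both something smaller and something larger follow it.  So σ avoids T₁ iff every
-- entry is a left-to-right maximum, or the smallest or the largest of the entries from it on.
-- Write σ = α n β with k = |β|.  The entries of α are new maxima or the smallest unused value, and
-- those of β extreme among the remaining ones, which gives max(1, 2^(k-1)) choices for β.  Reading
-- the values skipped by a new maximum as up-steps and the entries of α as down-steps turns α into a
-- lattice path from height 0 to height k that stays nonnegative and carries a factor w for each
-- peak; by last passages, their series is C^(k+1) where B = xyw C(xy, w).  The factors 1, 1, 2, 4, …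
-- are precisely the ones for which multiplying the series J by 2B - yw leaves only B (B - yw).

open import Defs
open import Data.Bool using (Bool; true; false; T; _∧_; not)
open import Data.Bool.ListAction using (all)
open import Data.Bool.Properties using (T-≡; ¬-not; ∧-conicalˡ; ∧-conicalʳ; ∧-zeroʳ)
open import Data.Empty using (⊥; ⊥-elim)
open import Data.Integer using (ℤ; 0ℤ; 1ℤ; -1ℤ)
  renaming (+_ to ofℕ; _+_ to infixl 6 _+ᶻ_; _*_ to infixl 7 _*ᶻ_; -_ to infix 8 -ᶻ_; _-_ to infixl 6 _⊟_)
import Data.Integer.Properties as ℤP
import Data.Integer.Tactic.RingSolver as ℤS
open import Data.List using (List; []; _∷_; _++_; _∷ʳ_; length; map; zip; upTo; concatMap; cartesianProductWith)
open import Data.List.Membership.Propositional using (_∈_; find)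
open import Data.List.Membership.Propositional.Properties
  using (∈-++⁺ˡ; ∈-++⁺ʳ; ∈-++⁻; ∈-map⁺; ∈-map⁻; ∈-∃++; ∈-cartesianProductWith⁺; ∈-cartesianProductWith⁻)
open import Data.List.Membership.Propositional.Properties.WithK using (unique∧set⇒bag)
open import Data.List.Properties
  using (length-map; length-++; length-upTo; upTo-∷ʳ; map-++; ∷-injective; ∷-injectiveʳ; ∷-injectiveˡ; ∷ʳ-++)
open import Data.List.Relation.Binary.BagAndSetEquality using (∼bag⇒↭)
open import Data.List.Relation.Binary.Permutation.Propositional
  using (_↭_; prep; ↭-refl; ↭-sym; ↭-trans; ↭-prep; ↭-swap; ↭-reflexive; ↭⇒↭ₛ)
open import Data.List.Relation.Binary.Permutation.Propositional.Properties
  using (∈-resp-↭; All-resp-↭; ↭-singleton-inv; ↭-empty-inv; ¬x∷xs↭[]; ∷↭∷ʳ; drop-∷; drop-mid; shift; ↭-length)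
import Data.List.Relation.Binary.Permutation.Setoid.Properties as ↭ₛ
open import Data.List.Relation.Binary.Sublist.Propositional using (_⊆_; []; _∷_; from∈)
  renaming (_∷ʳ_ to infixr 5 _∷⁻_)
open import Data.List.Relation.Binary.Sublist.Propositional.Properties using (All-resp-⊆)
open import Data.List.Relation.Unary.All as All using (All; []; _∷_)
open import Data.List.Relation.Unary.All.Properties as AllP using (++⁺; ¬All⇒Any¬)
open import Data.List.Relation.Unary.AllPairs as AllPairs using (AllPairs; []; _∷_)
import Data.List.Relation.Unary.AllPairs.Properties as AllPairsP
open import Data.List.Relation.Unary.Any as Any using (Any; here; there)
open import Data.List.Relation.Unary.Any.Properties using (any⁺; any⁻)
open import Data.List.Relation.Unary.Unique.Propositional using (Unique)
import Data.List.Relation.Unary.Unique.Propositional.Properties as Uniq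
open import Data.Nat
  using (ℕ; zero; suc; _+_; _*_; _^_; _∸_; _⊔_; _≤_; _<_; _<ᵇ_; _≡ᵇ_; z≤n; s≤s; z<s; _≟_; _≤?_; _<?_)
open import Data.Nat.Properties
open import Data.Nat.Tactic.RingSolver using (solve-∀)
open import Data.Product using (_×_; _,_; proj₁; proj₂; ∃-syntax)
open import Data.Sum as Sum using (_⊎_; inj₁; inj₂)
open import Data.Unit using (⊤; tt)
open import Function using (_∘_; flip; id; mk⇔; Equivalence)
open import Level using (0ℓ)
open import Relation.Binary.Core using (Rel)
open import Relation.Binary.Definitions using (Asymmetric; tri<; tri≈; tri>)
open import Relation.Binary.PropositionalEquality hiding (J)
open import Relation.Nullary using (¬_; yes; no; contradiction)

-- Counting lattice paths

-- Put t = xy and let b = 1, 1, 2, 4, ... be the numbers of choices for β. Sorting by k = |β| gives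
-- J = xyw Σ b_j x^j C^(j+1). The term j of J B and the term j + 1 of yw J carry the same power x^j
-- C^(j+2), so J (2B - yw) = B² - yw B amounts to 2 b_j - b_(j+1) = 1 for j = 0 and 0 afterwards.
-- This needs C^(j+1) · C = C^(j+2), and there is an obstacle: a permutation read from left to right
-- makes `F` recurse on the first step of a path, whereas the product calls for a recurrence in the
-- final height. `F-rec` bridges the two: it compares paths by their last step but is proved by
-- induction on the first. It encodes C = 1 + t (C² + (w - 1) C), where w - 1 corrects the weight of
-- an excursion that is a bare peak; the minus sign is why the path counts move from ℕ to ℤ. The
-- product rule then follows because both sides obey the same recurrence, with no bijection on
-- paths.

δ : ℕ → ℕ
δ zero    = 1
δ (suc l) = 0

-- F d u v l: paths from height v with u up-steps and d down-steps that never go below 0 and have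
-- l peaks.  R d u v l: those with d + 1 down-steps, the first of them right after an up-step.
-- Up-steps left over after the last down-step leave no choice, hence F 0 u v = δ.
mutual
  F : ℕ → ℕ → ℕ → ℕ → ℕ
  F zero    u v       l       = δ l
  F (suc d) u zero    l       = R d u zero l
  F (suc d) u (suc v) l       = F d u v l + R d u (suc v) l

  R : ℕ → ℕ → ℕ → ℕ → ℕ
  R d zero    v l       = 0
  R d (suc u) v zero    = 0
  R d (suc u) v (suc l) = F d u v l + R d u (suc v) (suc l)

w· : (ℕ → ℕ) → ℕ → ℕ
w· f zero    = 0
w· f (suc l) = f l

w·-+ : ∀ f g l → w· (λ l → f l + g l) l ≡ w· f l + w· g l
w·-+ f g zero    = refl
w·-+ f g (suc l) = refl

R-l0 : ∀ d u v → R d u v 0 ≡ 0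
R-l0 d zero    v = refl
R-l0 d (suc u) v = refl

R-suc : ∀ d u v l → R d (suc u) v l ≡ w· (F d u v) l + R d u (suc v) l
R-suc d u v zero    = sym (R-l0 d u (suc v))
R-suc d u v (suc l) = refl

R-zero-indep : ∀ u v l → R 0 u (suc v) l ≡ R 0 u v l
R-zero-indep zero    v l       = refl
R-zero-indep (suc u) v zero    = refl
R-zero-indep (suc u) v (suc l) = cong (δ l +_) (R-zero-indep u (suc v) (suc l))

R-zero-suc : ∀ u v l → R 0 (suc u) v l ≡ w· δ l + R 0 u v l
R-zero-suc u v l = trans (R-suc 0 u v l) (cong (w· δ l +_) (R-zero-indep u v l))

F-no-larger : ∀ d v l → d ≤ v → F d 0 v l ≡ δ l
F-no-larger zero    v       l       _         = refl
F-no-larger (suc d) (suc v) l       (s≤s d≤v) = trans (+-identityʳ _) (F-no-larger d v l d≤v)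

mutual
  F-too-long : ∀ d u v l → u + v < d → F d u v l ≡ 0
  F-too-long (suc d) u zero    l (s≤s p) = R-too-long d u 0 l (s≤s p)
  F-too-long (suc d) u (suc v) l (s≤s p) =
    cong₂ _+_ (F-too-long d u v l (subst (_≤ d) (+-suc u v) p)) (R-too-long d u (suc v) l (s≤s p))

  R-too-long : ∀ d u v l → u + v < suc d → R d u v l ≡ 0
  R-too-long d zero    v l       p       = refl
  R-too-long d (suc u) v zero    p       = refl
  R-too-long d (suc u) v (suc l) (s≤s p) =
    cong₂ _+_ (F-too-long d u v l p)
              (R-too-long d u (suc v) (suc l) (s≤s (subst (_≤ d) (sym (+-suc u v)) p)))

private
  interchange : ∀ a b c d → (a + c) + (b + d) ≡ (a + b) + (c + d)
  interchange = solve-∀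

  interchange₃ : ∀ a b c d e f → (a + b + c) + (d + e + f) ≡ (a + d) + (b + e) + (c + f)
  interchange₃ = solve-∀

  first-step : ∀ s r t x → s + (t + r) + x ≡ s + r + x + t
  first-step = solve-∀

  first-step₀ : ∀ r t x → (t + r) + x ≡ r + x + t
  first-step₀ = solve-∀

-- Comparing paths with u + 1 and with u up-steps: the last step of a path is up, or is the
-- down-step of a final peak (the term w·), or is a down-step after a down-step.
mutual
  F-rec : ∀ d u v l → d ≤ u + v →
          F (suc d) (suc u) v l + F d u v l ≡ F (suc d) u v l + F d (suc u) v l + w· (F d u v) l
  F-rec zero u zero l _ =
    trans (cong (_+ δ l) (R-zero-suc u 0 l)) (first-step₀ (R 0 u 0 l) _ _)
  F-rec zero u (suc v) l _ =
    trans (cong (λ r → δ l + r + δ l) (R-zero-suc u (suc v) l))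
          (first-step (δ l) (R 0 u (suc v) l) _ _)
  F-rec (suc d) u zero    l p = R-rec d u 0 l p
  F-rec (suc d) u (suc v) l p = begin
    (F (suc d) (suc u) v l + R (suc d) (suc u) (suc v) l) + (F d u v l + R d u (suc v) l)
      ≡⟨ interchange (F (suc d) (suc u) v l) (F d u v l) _ _ ⟩
    (F (suc d) (suc u) v l + F d u v l) + (R (suc d) (suc u) (suc v) l + R d u (suc v) l)
      ≡⟨ cong₂ _+_ (F-rec d u v l (≤-pred (subst (suc d ≤_) (+-suc u v) p))) (R-rec d u (suc v) l p) ⟩
    (F (suc d) u v l + F d (suc u) v l + w· (F d u v) l)
      + (R (suc d) u (suc v) l + R d (suc u) (suc v) l + w· (R d u (suc v)) l)
      ≡⟨ interchange₃ (F (suc d) u v l) _ _ _ _ _ ⟩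
    F (suc (suc d)) u (suc v) l + F (suc d) (suc u) (suc v) l + (w· (F d u v) l + w· (R d u (suc v)) l)
      ≡⟨ cong (F (suc (suc d)) u (suc v) l + F (suc d) (suc u) (suc v) l +_) (w·-+ (F d u v) (R d u (suc v)) l) ⟨
    F (suc (suc d)) u (suc v) l + F (suc d) (suc u) (suc v) l + w· (F (suc d) u (suc v)) l ∎
    where open ≡-Reasoning

  R-rec : ∀ d u v l → suc d ≤ u + v →
          R (suc d) (suc u) v l + R d u v l ≡ R (suc d) u v l + R d (suc u) v l + w· (R d u v) l
  R-rec d u       v zero    p rewrite R-l0 d u v | R-l0 (suc d) u v = refl
  -- With a single up-step only the path that rises once and then descends remains, and both sides
  -- count it. The bound `suc d ≤ v` is essential here: at `d = v` the longer descent would go below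
  -- 0 and the shorter one would not.
  R-rec d zero    v (suc l) p =
    cong (_+ 0) (cong (_+ 0) (trans (F-no-larger (suc d) v l p)
                                    (sym (F-no-larger d v l (≤-trans (n≤1+n d) p)))))
  R-rec d (suc u) v (suc l) p = begin
    (F (suc d) (suc u) v l + R (suc d) (suc u) (suc v) (suc l)) + (F d u v l + R d u (suc v) (suc l))
      ≡⟨ interchange (F (suc d) (suc u) v l) (F d u v l) _ _ ⟩
    (F (suc d) (suc u) v l + F d u v l) + (R (suc d) (suc u) (suc v) (suc l) + R d u (suc v) (suc l))
      ≡⟨ cong₂ _+_ (F-rec d u v l (≤-pred p)) (R-rec d u (suc v) (suc l) (subst (suc d ≤_) (sym (+-suc u v)) p)) ⟩
    (F (suc d) u v l + F d (suc u) v l + w· (F d u v) l)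
      + (R (suc d) u (suc v) (suc l) + R d (suc u) (suc v) (suc l) + R d u (suc v) l)
      ≡⟨ interchange₃ (F (suc d) u v l) _ _ _ _ _ ⟩
    R (suc d) (suc u) v (suc l) + R d (suc (suc u)) v (suc l) + (w· (F d u v) l + R d u (suc v) l)
      ≡⟨ cong (R (suc d) (suc u) v (suc l) + R d (suc (suc u)) v (suc l) +_) (R-suc d u v l) ⟨
    R (suc d) (suc u) v (suc l) + R d (suc (suc u)) v (suc l) + R d (suc u) v l ∎
    where open ≡-Reasoning

-- Products of the path series

-- The Cauchy sum over `a + b = n`. Recursion on `n` produces both indices without the truncated
-- subtraction of `sumTo`; `sumTo-diag` translates between the two.
diag : ℕ → (ℕ → ℕ → ℤ) → ℤ
diag zero    h = h 0 0
diag (suc n) h = h 0 (suc n) +ᶻ diag n (h ∘ suc)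

diag-cong : ∀ n {h k : ℕ → ℕ → ℤ} → (∀ a b → h a b ≡ k a b) → diag n h ≡ diag n k
diag-cong zero    eq = eq 0 0
diag-cong (suc n) eq = cong₂ _+ᶻ_ (eq 0 (suc n)) (diag-cong n (eq ∘ suc))

diag-0 : ∀ n {h : ℕ → ℕ → ℤ} → (∀ a b → h a b ≡ 0ℤ) → diag n h ≡ 0ℤ
diag-0 zero    eq = eq 0 0
diag-0 (suc n) eq = cong₂ _+ᶻ_ (eq 0 (suc n)) (diag-0 n (eq ∘ suc))

private
  +-interchange : ∀ a b c d → (a +ᶻ b) +ᶻ (c +ᶻ d) ≡ (a +ᶻ c) +ᶻ (b +ᶻ d)
  +-interchange = ℤS.solve-∀

diag-+ : ∀ n (h k : ℕ → ℕ → ℤ) → diag n (λ a b → h a b +ᶻ k a b) ≡ diag n h +ᶻ diag n k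
diag-+ zero    h k = refl
diag-+ (suc n) h k =
  trans (cong (h 0 (suc n) +ᶻ k 0 (suc n) +ᶻ_) (diag-+ n (h ∘ suc) (k ∘ suc)))
        (+-interchange (h 0 (suc n)) (k 0 (suc n)) _ _)

diag-*ˡ : ∀ n c (h : ℕ → ℕ → ℤ) → diag n (λ a b → c *ᶻ h a b) ≡ c *ᶻ diag n h
diag-*ˡ zero    c h = refl
diag-*ˡ (suc n) c h =
  trans (cong (c *ᶻ h 0 (suc n) +ᶻ_) (diag-*ˡ n c (h ∘ suc))) (sym (ℤP.*-distribˡ-+ c (h 0 (suc n)) _))

diag-last : ∀ n (h : ℕ → ℕ → ℤ) → diag (suc n) h ≡ diag n (λ a b → h a (suc b)) +ᶻ h (suc n) 0
diag-last zero    h = refl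
diag-last (suc n) h = trans (cong (h 0 (suc (suc n)) +ᶻ_) (diag-last n (h ∘ suc))) (sym (ℤP.+-assoc (h 0 (suc (suc n))) _ _))

infixl 7 _⋆_
_⋆_ : (ℕ → ℤ) → (ℕ → ℤ) → ℕ → ℤ
(f ⋆ g) l = diag l (λ c c′ → f c *ᶻ g c′)

w·ᶻ : (ℕ → ℤ) → ℕ → ℤ
w·ᶻ f zero    = 0ℤ
w·ᶻ f (suc l) = f l

⋆-congˡ : ∀ {f f′} g l → (∀ c → f c ≡ f′ c) → (f ⋆ g) l ≡ (f′ ⋆ g) l
⋆-congˡ g l eq = diag-cong l (λ c c′ → cong (_*ᶻ g c′) (eq c))

⋆-w·ᶻ : ∀ f g l → (w·ᶻ f ⋆ g) l ≡ w·ᶻ (f ⋆ g) l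
⋆-w·ᶻ f g zero    = refl
⋆-w·ᶻ f g (suc l) = ℤP.+-identityˡ _

δ⋆ : ∀ g l → ((ofℕ ∘ δ) ⋆ g) l ≡ g l
δ⋆ g zero    = ℤP.*-identityˡ (g 0)
δ⋆ g (suc l) = trans (cong₂ _+ᶻ_ (ℤP.*-identityˡ (g (suc l))) (diag-0 l (λ _ _ → refl))) (ℤP.+-identityʳ _)

-- The coefficients of C^(j+1): paths from height 0 to height j with m down-steps, weighted by peaks.
e : ℕ → ℕ → ℕ → ℤ
e m j l = ofℕ (F m (m + j) 0 l)

w·ᶻ-cong : ∀ {f g} l → (∀ c → f c ≡ g c) → w·ᶻ f l ≡ w·ᶻ g l
w·ᶻ-cong zero    eq = refl
w·ᶻ-cong (suc l) eq = eq l

w·ᶻ-cast : ∀ f l → ofℕ (w· f l) ≡ w·ᶻ (ofℕ ∘ f) l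
w·ᶻ-cast f zero    = refl
w·ᶻ-cast f (suc l) = refl

private
  isolate : ∀ a b c d s → a +ᶻ b ≡ c +ᶻ d +ᶻ s → a ≡ c +ᶻ (d +ᶻ s +ᶻ -ᶻ b)
  isolate a b c d s eq = trans (lemma₁ a b) (trans (cong (_+ᶻ -ᶻ b) eq) (lemma₂ b c d s))
    where
    lemma₁ : ∀ a b → a ≡ a +ᶻ b +ᶻ -ᶻ b
    lemma₁ = ℤS.solve-∀
    lemma₂ : ∀ b c d s → c +ᶻ d +ᶻ s +ᶻ -ᶻ b ≡ c +ᶻ (d +ᶻ s +ᶻ -ᶻ b)
    lemma₂ = ℤS.solve-∀

-- The coefficients of C^j, meant for a positive number of down-steps: there C^0 = 1 contributes
-- nothing, whence the 0 at `j = 0`.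
below : ℕ → ℕ → ℕ → ℤ
below m zero    l = 0ℤ
below m (suc j) l = e m j l

F-recᶻ : ∀ d u l → d ≤ u →
        ofℕ (F (suc d) (suc u) 0 l)
        ≡ ofℕ (F (suc d) u 0 l) +ᶻ (ofℕ (F d (suc u) 0 l) +ᶻ w·ᶻ (ofℕ ∘ F d u 0) l +ᶻ -ᶻ ofℕ (F d u 0 l))
F-recᶻ d u l d≤u = isolate (ofℕ (F (suc d) (suc u) 0 l)) (ofℕ (F d u 0 l)) (ofℕ (F (suc d) u 0 l)) (ofℕ (F d (suc u) 0 l))
          (w·ᶻ (ofℕ ∘ F d u 0) l) (begin
  ofℕ (F (suc d) (suc u) 0 l) +ᶻ ofℕ (F d u 0 l)
    ≡⟨ ℤP.pos-+ (F (suc d) (suc u) 0 l) _ ⟨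
  ofℕ (F (suc d) (suc u) 0 l + F d u 0 l)
    ≡⟨ cong ofℕ (F-rec d u 0 l (subst (d ≤_) (sym (+-identityʳ u)) d≤u)) ⟩
  ofℕ (F (suc d) u 0 l + F d (suc u) 0 l + w· (F d u 0) l)
    ≡⟨ ℤP.pos-+ (F (suc d) u 0 l + F d (suc u) 0 l) _ ⟩
  ofℕ (F (suc d) u 0 l + F d (suc u) 0 l) +ᶻ ofℕ (w· (F d u 0) l)
    ≡⟨ cong₂ _+ᶻ_ (ℤP.pos-+ (F (suc d) u 0 l) _) (w·ᶻ-cast (F d u 0) l) ⟩
  ofℕ (F (suc d) u 0 l) +ᶻ ofℕ (F d (suc u) 0 l) +ᶻ w·ᶻ (ofℕ ∘ F d u 0) l ∎)
  where open ≡-Reasoning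

-- The coefficient form of C^(j+1) = C^j + t (C^(j+2) + (w - 1) C^(j+1)), at `suc m` down-steps.
e-step : ∀ m j l → e (suc m) j l
         ≡ below (suc m) j l +ᶻ (e m (suc j) l +ᶻ w·ᶻ (e m j) l +ᶻ -ᶻ e m j l)
e-step m j l = trans (F-recᶻ m (m + j) l (m≤m+n m j))
  (cong₂ _+ᶻ_ (prev j) (cong (λ u → ofℕ (F m u 0 l) +ᶻ w·ᶻ (e m j) l +ᶻ -ᶻ e m j l) (sym (+-suc m j))))
  where
  prev : ∀ j → ofℕ (F (suc m) (m + j) 0 l) ≡ below (suc m) j l
  prev zero    = cong ofℕ (F-too-long (suc m) (m + 0) 0 l (s≤s (≤-reflexive (trans (+-identityʳ _) (+-identityʳ m)))))
  prev (suc j) = cong (λ u → ofℕ (F (suc m) u 0 l)) (+-suc m j)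

conv : ℕ → ℕ → ℕ → ℤ
conv m j l = diag m (λ i i′ → (e i j ⋆ e i′ 0) l)

diag-w·ᶻ : ∀ m (h : ℕ → ℕ → ℕ → ℤ) l →
             diag m (λ a b → w·ᶻ (h a b) l) ≡ w·ᶻ (λ l → diag m (λ a b → h a b l)) l
diag-w·ᶻ m h zero    = diag-0 m (λ _ _ → refl)
diag-w·ᶻ m h (suc l) = refl

diag-neg : ∀ n (h : ℕ → ℕ → ℤ) → diag n (λ a b → -ᶻ h a b) ≡ -ᶻ diag n h
diag-neg n h = trans (diag-cong n (λ a b → sym (ℤP.-1*i≡-i (h a b)))) (trans (diag-*ˡ n -1ℤ h) (ℤP.-1*i≡-i _))

diag-combination : ∀ n (h₁ h₂ h₃ h₄ : ℕ → ℕ → ℤ) →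
                   diag n (λ a b → h₁ a b +ᶻ (h₂ a b +ᶻ h₃ a b +ᶻ -ᶻ h₄ a b))
                   ≡ diag n h₁ +ᶻ (diag n h₂ +ᶻ diag n h₃ +ᶻ -ᶻ diag n h₄)
diag-combination n h₁ h₂ h₃ h₄ = begin
  diag n (λ a b → h₁ a b +ᶻ (h₂ a b +ᶻ h₃ a b +ᶻ -ᶻ h₄ a b))
    ≡⟨ diag-+ n h₁ _ ⟩
  diag n h₁ +ᶻ diag n (λ a b → h₂ a b +ᶻ h₃ a b +ᶻ -ᶻ h₄ a b)
    ≡⟨ cong (diag n h₁ +ᶻ_) (diag-+ n (λ a b → h₂ a b +ᶻ h₃ a b) _) ⟩
  diag n h₁ +ᶻ (diag n (λ a b → h₂ a b +ᶻ h₃ a b) +ᶻ diag n (λ a b → -ᶻ h₄ a b))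
    ≡⟨ cong (diag n h₁ +ᶻ_) (cong₂ _+ᶻ_ (diag-+ n h₂ h₃) (diag-neg n h₄)) ⟩
  diag n h₁ +ᶻ (diag n h₂ +ᶻ diag n h₃ +ᶻ -ᶻ diag n h₄) ∎
  where open ≡-Reasoning

⋆-combination : ∀ f₁ f₂ f₃ f₄ g l →
                ((λ c → f₁ c +ᶻ (f₂ c +ᶻ w·ᶻ f₃ c +ᶻ -ᶻ f₄ c)) ⋆ g) l
                ≡ (f₁ ⋆ g) l +ᶻ ((f₂ ⋆ g) l +ᶻ w·ᶻ (f₃ ⋆ g) l +ᶻ -ᶻ (f₄ ⋆ g) l)
⋆-combination f₁ f₂ f₃ f₄ g l = begin
  ((λ c → f₁ c +ᶻ (f₂ c +ᶻ w·ᶻ f₃ c +ᶻ -ᶻ f₄ c)) ⋆ g) l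
    ≡⟨ diag-cong l (λ c c′ → distribute (f₁ c) (f₂ c) (w·ᶻ f₃ c) (f₄ c) (g c′)) ⟩
  diag l (λ c c′ → f₁ c *ᶻ g c′ +ᶻ (f₂ c *ᶻ g c′ +ᶻ w·ᶻ f₃ c *ᶻ g c′ +ᶻ -ᶻ (f₄ c *ᶻ g c′)))
    ≡⟨ diag-combination l (λ c c′ → f₁ c *ᶻ g c′) (λ c c′ → f₂ c *ᶻ g c′)
                          (λ c c′ → w·ᶻ f₃ c *ᶻ g c′) (λ c c′ → f₄ c *ᶻ g c′) ⟩
  (f₁ ⋆ g) l +ᶻ ((f₂ ⋆ g) l +ᶻ (w·ᶻ f₃ ⋆ g) l +ᶻ -ᶻ (f₄ ⋆ g) l)
    ≡⟨ cong (λ x → (f₁ ⋆ g) l +ᶻ ((f₂ ⋆ g) l +ᶻ x +ᶻ -ᶻ (f₄ ⋆ g) l)) (⋆-w·ᶻ f₃ g l) ⟩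
  (f₁ ⋆ g) l +ᶻ ((f₂ ⋆ g) l +ᶻ w·ᶻ (f₃ ⋆ g) l +ᶻ -ᶻ (f₄ ⋆ g) l) ∎
  where
  open ≡-Reasoning
  distribute : ∀ a b c d x → (a +ᶻ (b +ᶻ c +ᶻ -ᶻ d)) *ᶻ x
               ≡ a *ᶻ x +ᶻ (b *ᶻ x +ᶻ c *ᶻ x +ᶻ -ᶻ (d *ᶻ x))
  distribute = ℤS.solve-∀

-- `e-step` is linear, so it can be applied to the left factor inside the product. The terms whose
-- left factor has no down-step lie outside the recurrence and are added back in `e-convolution`.
conv-step : ∀ m j l →
            diag m (λ i i′ → (e (suc i) j ⋆ e i′ 0) l)
            ≡ diag m (λ i i′ → (below (suc i) j ⋆ e i′ 0) l)
              +ᶻ (conv m (suc j) l +ᶻ w·ᶻ (conv m j) l +ᶻ -ᶻ conv m j l)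
conv-step m j l = begin
  diag m (λ i i′ → (e (suc i) j ⋆ e i′ 0) l)
    ≡⟨ diag-cong m (λ i i′ → trans (⋆-congˡ {e (suc i) j} (e i′ 0) l (e-step i j))
                                   (⋆-combination (below (suc i) j) (e i (suc j)) (e i j) (e i j) (e i′ 0) l)) ⟩
  diag m (λ i i′ → (below (suc i) j ⋆ e i′ 0) l
                   +ᶻ ((e i (suc j) ⋆ e i′ 0) l +ᶻ w·ᶻ (e i j ⋆ e i′ 0) l +ᶻ -ᶻ (e i j ⋆ e i′ 0) l))
    ≡⟨ diag-combination m (λ i i′ → (below (suc i) j ⋆ e i′ 0) l) (λ i i′ → (e i (suc j) ⋆ e i′ 0) l)
                          (λ i i′ → w·ᶻ (e i j ⋆ e i′ 0) l) (λ i i′ → (e i j ⋆ e i′ 0) l) ⟩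
  diag m (λ i i′ → (below (suc i) j ⋆ e i′ 0) l)
    +ᶻ (conv m (suc j) l +ᶻ diag m (λ i i′ → w·ᶻ (e i j ⋆ e i′ 0) l) +ᶻ -ᶻ conv m j l)
    ≡⟨ cong (λ x → diag m (λ i i′ → (below (suc i) j ⋆ e i′ 0) l) +ᶻ (conv m (suc j) l +ᶻ x +ᶻ -ᶻ conv m j l))
            (diag-w·ᶻ m (λ i i′ → e i j ⋆ e i′ 0) l) ⟩
  diag m (λ i i′ → (below (suc i) j ⋆ e i′ 0) l)
    +ᶻ (conv m (suc j) l +ᶻ w·ᶻ (conv m j) l +ᶻ -ᶻ conv m j l) ∎
  where open ≡-Reasoning

-- Last-passage decomposition: C^(j+1) · C = C^(j+2).
e-convolution : ∀ m j l → conv m j l ≡ e m (suc j) l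
e-convolution zero    j l = δ⋆ (ofℕ ∘ δ) l
e-convolution (suc m) j l = conv-suc j
  where
  open ≡-Reasoning
  tail : ℕ → ℤ
  tail j = conv m (suc j) l +ᶻ w·ᶻ (conv m j) l +ᶻ -ᶻ conv m j l

  tail-≡ : ∀ j → tail j ≡ e m (suc (suc j)) l +ᶻ w·ᶻ (e m (suc j)) l +ᶻ -ᶻ e m (suc j) l
  tail-≡ j = cong₂ _+ᶻ_ (cong₂ _+ᶻ_ (e-convolution m (suc j) l) (w·ᶻ-cong {conv m j} l (e-convolution m j)))
                         (cong -ᶻ_ (e-convolution m j l))

  -- An inner induction on `j`, inside the one on `m`: `tail` involves only smaller `m`, and `below`
  -- lowers `j` by one. At `j = 0` only the summand with left factor `e 0 0`, which is the unit `δ`,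
  -- survives.
  mutual
    conv-suc : ∀ j → conv (suc m) j l ≡ e (suc m) (suc j) l
    conv-suc j = begin
      (e 0 j ⋆ e (suc m) 0) l +ᶻ diag m (λ i i′ → (e (suc i) j ⋆ e i′ 0) l)
        ≡⟨ cong ((e 0 j ⋆ e (suc m) 0) l +ᶻ_) (conv-step m j l) ⟩
      (e 0 j ⋆ e (suc m) 0) l +ᶻ (diag m (λ i i′ → (below (suc i) j ⋆ e i′ 0) l) +ᶻ tail j)
        ≡⟨ ℤP.+-assoc ((e 0 j ⋆ e (suc m) 0) l) _ (tail j) ⟨
      (e 0 j ⋆ e (suc m) 0) l +ᶻ diag m (λ i i′ → (below (suc i) j ⋆ e i′ 0) l) +ᶻ tail j
        ≡⟨ cong₂ _+ᶻ_ (conv-below j) (tail-≡ j) ⟩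
      e (suc m) j l +ᶻ (e m (suc (suc j)) l +ᶻ w·ᶻ (e m (suc j)) l +ᶻ -ᶻ e m (suc j) l)
        ≡⟨ e-step m (suc j) l ⟨
      e (suc m) (suc j) l ∎

    conv-below : ∀ j → (e 0 j ⋆ e (suc m) 0) l +ᶻ diag m (λ i i′ → (below (suc i) j ⋆ e i′ 0) l) ≡ e (suc m) j l
    conv-below zero    =
      trans (cong₂ _+ᶻ_ (δ⋆ (e (suc m) 0) l) (diag-0 m (λ i i′ → diag-0 l (λ _ _ → refl)))) (ℤP.+-identityʳ _)
    conv-below (suc j) = conv-suc j

-- The avoidance condition

∈-subseqs⇒⊆ : ∀ {s} σ → s ∈ subseqs σ → s ⊆ σ
∈-subseqs⇒⊆ []      (here refl) = []
∈-subseqs⇒⊆ (x ∷ σ) i with ∈-++⁻ (map (x ∷_) (subseqs σ)) i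
... | inj₂ j = x ∷⁻ ∈-subseqs⇒⊆ σ j
... | inj₁ j with ∈-map⁻ (x ∷_) j
...   | _ , k , refl = refl ∷ ∈-subseqs⇒⊆ σ k

⊆⇒∈-subseqs : ∀ {s σ : List ℕ} → s ⊆ σ → s ∈ subseqs σ
⊆⇒∈-subseqs []         = here refl
⊆⇒∈-subseqs {σ = _ ∷ σ} (x ∷⁻ p) = ∈-++⁺ʳ (map (x ∷_) (subseqs σ)) (⊆⇒∈-subseqs p)
⊆⇒∈-subseqs (refl ∷ p) = ∈-++⁺ˡ (∈-map⁺ (_ ∷_) (⊆⇒∈-subseqs p))

<⇒<ᵇ≡true : ∀ {m n} → m < n → (m <ᵇ n) ≡ true
<⇒<ᵇ≡true p = Equivalence.to T-≡ (<⇒<ᵇ p)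

≤⇒<ᵇ≡false : ∀ {m n} → n ≤ m → (m <ᵇ n) ≡ false
≤⇒<ᵇ≡false p = ¬-not (λ eq → <⇒≱ (<ᵇ⇒< _ _ (Equivalence.from T-≡ eq)) p)

<ᵇ≡true⇒< : ∀ {m n} → (m <ᵇ n) ≡ true → m < n
<ᵇ≡true⇒< eq = <ᵇ⇒< _ _ (Equivalence.from T-≡ eq)

-- The predicate stays abstract because `sameOrderᵇ` uses an anonymous function, which unification
-- has to supply.
all-∧⁻ : ∀ {A : Set} (f : A → Bool) zs {S} → (all f zs ∧ S) ≡ true →
         S ≡ true × (∀ {z} → z ∈ zs → f z ≡ true)
all-∧⁻ f []       eq = eq , λ ()
all-∧⁻ f (z ∷ zs) eq with f z in fz
... | true with all-∧⁻ f zs eq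
...   | s , rest = s , λ { (here refl) → fz ; (there i) → rest i }

sameOrder-∷⁻ : ∀ s b t → sameOrderᵇ s (b ∷ t) ≡ true →
               ∃[ a ] ∃[ s′ ] s ≡ a ∷ s′ × sameOrderᵇ s′ t ≡ true
               × (∀ {x y} → (x , y) ∈ zip s′ t → (a <ᵇ x) ≡ (b <ᵇ y) × (x <ᵇ a) ≡ (y <ᵇ b))
sameOrder-∷⁻ (a ∷ s) b t eq with all-∧⁻ _ (zip s t) {sameOrderᵇ s t} eq
... | same , pairs = a , s , refl , same , pair
  where
  pair : ∀ {x y} → (x , y) ∈ zip s t → (a <ᵇ x) ≡ (b <ᵇ y) × (x <ᵇ a) ≡ (y <ᵇ b)
  -- `eqB` is local to the definition of `sameOrderᵇ` and cannot be named here. On concrete Booleans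
  -- it computes, and a mismatch turns `pairs i` into an absurd equation.
  pair {x} {y} i with a <ᵇ x | b <ᵇ y | x <ᵇ a | y <ᵇ b | pairs i
  ... | true  | true  | true  | true  | _  = refl , refl
  ... | true  | true  | false | false | _  = refl , refl
  ... | false | false | true  | true  | _  = refl , refl
  ... | false | false | false | false | _  = refl , refl
  ... | true  | false | _     | _     | ()
  ... | false | true  | _     | _     | ()
  ... | true  | true  | true  | false | ()
  ... | true  | true  | false | true  | ()
  ... | false | false | true  | false | ()
  ... | false | false | false | true  | ()

data Straddles (b : ℕ) : ℕ → ℕ → Set where
  low-high : ∀ {c d} → c < b → b < d → Straddles b c d
  high-low : ∀ {c d} → d < b → b < c → Straddles b c d

-- The four patterns of T₁ are exactly the occurrences a b c d with b < a and b strictly between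
-- c and d.
Avoids : List ℕ → Set
Avoids σ = ∀ {a b c d} → (a ∷ b ∷ c ∷ d ∷ []) ⊆ σ → b < a → ¬ Straddles b c d

private
  #0 : ∀ {A : Set} {x : A} {xs} → x ∈ x ∷ xs
  #0 = here refl

  #1 : ∀ {A : Set} {x y : A} {xs} → x ∈ y ∷ x ∷ xs
  #1 = there #0

sameOrder-[] : ∀ s → sameOrderᵇ s [] ≡ true → s ≡ []
sameOrder-[] [] _ = refl

-- Only comparisons with the second entry are kept. They are what `Bad` asks for; how `a` compares
-- with `c` and `d` merely tells the patterns of T₁ apart.
sameOrder-length4 : ∀ s p q r t → sameOrderᵇ s (p ∷ q ∷ r ∷ t ∷ []) ≡ true →
                    ∃[ a ] ∃[ b ] ∃[ c ] ∃[ d ] s ≡ a ∷ b ∷ c ∷ d ∷ []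
                    × (b <ᵇ a) ≡ (q <ᵇ p)
                    × ((b <ᵇ c) ≡ (q <ᵇ r) × (c <ᵇ b) ≡ (r <ᵇ q))
                    × ((b <ᵇ d) ≡ (q <ᵇ t) × (d <ᵇ b) ≡ (t <ᵇ q))
sameOrder-length4 s p q r t eq
  with a , s₁ , refl , eq₁ , ps ← sameOrder-∷⁻ s p (q ∷ r ∷ t ∷ []) eq
  with b , s₂ , refl , eq₂ , qs ← sameOrder-∷⁻ s₁ q (r ∷ t ∷ []) eq₁
  with c , s₃ , refl , eq₃ , _  ← sameOrder-∷⁻ s₂ r (t ∷ []) eq₂
  with d , s₄ , refl , eq₄ , _  ← sameOrder-∷⁻ s₃ t [] eq₃
  with refl ← sameOrder-[] s₄ eq₄
  = a , b , c , d , refl , proj₂ (ps #0) , qs #0 , qs #1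

Bad : List ℕ → Set
Bad s = ∃[ a ] ∃[ b ] ∃[ c ] ∃[ d ] s ≡ a ∷ b ∷ c ∷ d ∷ [] × b < a × Straddles b c d

sameOrder-T₁⇒Bad : ∀ {s τ} → τ ∈ T₁ → sameOrderᵇ s τ ≡ true → Bad s
sameOrder-T₁⇒Bad {s} (here refl) eq with sameOrder-length4 s _ _ _ _ eq
... | a , b , c , d , s≡ , ba , (_ , cb) , (bd , _) =
  a , b , c , d , s≡ , <ᵇ≡true⇒< ba , low-high (<ᵇ≡true⇒< cb) (<ᵇ≡true⇒< bd)
sameOrder-T₁⇒Bad {s} (there (here refl)) eq with sameOrder-length4 s _ _ _ _ eq
... | a , b , c , d , s≡ , ba , (bc , _) , (_ , db) =
  a , b , c , d , s≡ , <ᵇ≡true⇒< ba , high-low (<ᵇ≡true⇒< db) (<ᵇ≡true⇒< bc)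
sameOrder-T₁⇒Bad {s} (there (there (here refl))) eq with sameOrder-length4 s _ _ _ _ eq
... | a , b , c , d , s≡ , ba , (_ , cb) , (bd , _) =
  a , b , c , d , s≡ , <ᵇ≡true⇒< ba , low-high (<ᵇ≡true⇒< cb) (<ᵇ≡true⇒< bd)
sameOrder-T₁⇒Bad {s} (there (there (there (here refl)))) eq with sameOrder-length4 s _ _ _ _ eq
... | a , b , c , d , s≡ , ba , (bc , _) , (_ , db) =
  a , b , c , d , s≡ , <ᵇ≡true⇒< ba , high-low (<ᵇ≡true⇒< db) (<ᵇ≡true⇒< bc)

private
  lt : ∀ {m n} → m < n → (m <ᵇ n) ≡ true
  lt = <⇒<ᵇ≡true

  gt : ∀ {m n} → m < n → (n <ᵇ m) ≡ false
  gt p = ≤⇒<ᵇ≡false (<⇒≤ p)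

3214-order : ∀ {a b c d} → c < b → b < a → a < d →
             sameOrderᵇ (a ∷ b ∷ c ∷ d ∷ []) (3 ∷ 2 ∷ 1 ∷ 4 ∷ []) ≡ true
3214-order cb ba ad
  rewrite gt ba | lt ba | gt (<-trans cb ba) | lt (<-trans cb ba) | lt ad | gt ad
        | gt cb | lt cb | lt (<-trans ba ad) | gt (<-trans ba ad)
        | lt (<-trans cb (<-trans ba ad)) | gt (<-trans cb (<-trans ba ad)) = refl

3241-order : ∀ {a b c d} → d < b → b < a → a < c →
             sameOrderᵇ (a ∷ b ∷ c ∷ d ∷ []) (3 ∷ 2 ∷ 4 ∷ 1 ∷ []) ≡ true
3241-order db ba ac
  rewrite gt ba | lt ba | lt ac | gt ac | gt (<-trans db ba) | lt (<-trans db ba)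
        | lt (<-trans ba ac) | gt (<-trans ba ac) | gt db | lt db
        | gt (<-trans db (<-trans ba ac)) | lt (<-trans db (<-trans ba ac)) = refl

4213-order : ∀ {a b c d} → c < b → b < d → d < a →
             sameOrderᵇ (a ∷ b ∷ c ∷ d ∷ []) (4 ∷ 2 ∷ 1 ∷ 3 ∷ []) ≡ true
4213-order cb bd da
  rewrite gt (<-trans bd da) | lt (<-trans bd da)
        | gt (<-trans cb (<-trans bd da)) | lt (<-trans cb (<-trans bd da)) | gt da | lt da
        | gt cb | lt cb | lt bd | gt bd | lt (<-trans cb bd) | gt (<-trans cb bd) = refl

4231-order : ∀ {a b c d} → d < b → b < c → c < a →
             sameOrderᵇ (a ∷ b ∷ c ∷ d ∷ []) (4 ∷ 2 ∷ 3 ∷ 1 ∷ []) ≡ true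
4231-order db bc ca
  rewrite gt (<-trans bc ca) | lt (<-trans bc ca) | gt ca | lt ca
        | gt (<-trans db (<-trans bc ca)) | lt (<-trans db (<-trans bc ca))
        | lt bc | gt bc | gt db | lt db | gt (<-trans db bc) | lt (<-trans db bc) = refl

-- The constructor of `Straddles` tells which of `c` and `d` is the larger; comparing that one with
-- `a` selects one of two patterns. Distinctness rules out ties.
Bad⇒sameOrder-T₁ : ∀ {a b c d} → a ≢ c → a ≢ d → b < a → Straddles b c d →
                   ∃[ τ ] τ ∈ T₁ × sameOrderᵇ (a ∷ b ∷ c ∷ d ∷ []) τ ≡ true
Bad⇒sameOrder-T₁ {a} {b} {c} {d} a≢c a≢d b<a (low-high c<b b<d) with <-cmp a d
... | tri< a<d _ _ = _ , here refl , 3214-order c<b b<a a<d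
... | tri≈ _ a≡d _ = contradiction a≡d a≢d
... | tri> _ _ d<a = _ , there (there (here refl)) , 4213-order c<b b<d d<a
Bad⇒sameOrder-T₁ {a} {b} {c} {d} a≢c a≢d b<a (high-low d<b b<c) with <-cmp a c
... | tri< a<c _ _ = _ , there (here refl) , 3241-order d<b b<a a<c
... | tri≈ _ a≡c _ = contradiction a≡c a≢c
... | tri> _ _ c<a = _ , there (there (there (here refl))) , 4231-order d<b b<c c<a

not≡true⇒¬T : ∀ {b} → not b ≡ true → ¬ T b
not≡true⇒¬T {false} _ ()

¬T⇒not≡true : ∀ {b} → ¬ T b → not b ≡ true
¬T⇒not≡true {false} _ = refl
¬T⇒not≡true {true}  n = contradiction tt n

Unique-⊆ : ∀ {s σ : List ℕ} → s ⊆ σ → Unique σ → Unique s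
Unique-⊆ []         _        = []
Unique-⊆ (x ∷⁻ p)   (_ ∷ us) = Unique-⊆ p us
Unique-⊆ (refl ∷ p) (u ∷ us) = All-resp-⊆ p u ∷ Unique-⊆ p us

avoidsT₁ᵇ⇒Avoids : ∀ σ → Unique σ → avoidsT₁ᵇ σ ≡ true → Avoids σ
avoidsT₁ᵇ⇒Avoids σ u eq sub b<a str with Unique-⊆ sub u
... | (_ ∷ a≢c ∷ a≢d ∷ []) ∷ _ with Bad⇒sameOrder-T₁ a≢c a≢d b<a str
... | τ , τ∈T₁ , same = not≡true⇒¬T eq
  (any⁺ (containsᵇ σ) (Any.map (λ { refl → any⁺ (λ s → sameOrderᵇ s τ)
    (Any.map (λ { refl → Equivalence.from T-≡ same }) (⊆⇒∈-subseqs sub)) }) τ∈T₁))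

Avoids⇒avoidsT₁ᵇ : ∀ σ → Avoids σ → avoidsT₁ᵇ σ ≡ true
Avoids⇒avoidsT₁ᵇ σ av = ¬T⇒not≡true λ t → impossible (any⁻ (containsᵇ σ) T₁ t)
  where
  impossible : ¬ Any (T ∘ containsᵇ σ) T₁
  impossible i with find i
  ... | τ , τ∈T₁ , t with find (any⁻ (λ s → sameOrderᵇ s τ) (subseqs σ) t)
  ... | s , s∈ , same with sameOrder-T₁⇒Bad {s} τ∈T₁ (Equivalence.to T-≡ same)
  ... | _ , _ , _ , _ , refl , b<a , str = av (∈-subseqs⇒⊆ σ s∈) b<a str

-- M is the largest entry so far: every later entry is a new maximum, or the smallest or the
-- largest of the entries from it on.
Good : ℕ → List ℕ → Set
Good M []      = ⊤
Good M (x ∷ τ) = (M < x × Good x τ) ⊎ (x < M × (All (x <_) τ ⊎ All (_< x) τ) × Good M τ)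

extreme⇒¬Straddles : ∀ {x c d τ} → All (x <_) τ ⊎ All (_< x) τ → (c ∷ d ∷ []) ⊆ τ → ¬ Straddles x c d
extreme⇒¬Straddles (inj₁ lo) sub str with All-resp-⊆ sub lo | str
... | x<c ∷ x<d ∷ [] | low-high c<x _ = <-asym c<x x<c
... | x<c ∷ x<d ∷ [] | high-low d<x _ = <-asym d<x x<d
extreme⇒¬Straddles (inj₂ hi) sub str with All-resp-⊆ sub hi | str
... | c<x ∷ d<x ∷ [] | low-high _ x<d = <-asym d<x x<d
... | c<x ∷ d<x ∷ [] | high-low _ x<c = <-asym c<x x<c

-- The running maximum only grows, so an entry below `M` cannot be a new maximum when its turn comes
-- and must be extreme.
Good⇒¬Straddles : ∀ {M b c d} τ → Good M τ → (b ∷ c ∷ d ∷ []) ⊆ τ → b < M → ¬ Straddles b c d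
Good⇒¬Straddles (x ∷ τ) (inj₁ (M<x , g))       (.x ∷⁻ p)  b<M = Good⇒¬Straddles τ g p (<-trans b<M M<x)
Good⇒¬Straddles (x ∷ τ) (inj₂ (_ , _ , g))     (.x ∷⁻ p)  b<M = Good⇒¬Straddles τ g p b<M
Good⇒¬Straddles (x ∷ τ) (inj₁ (M<x , g))       (refl ∷ p) b<M = contradiction M<x (<-asym b<M)
Good⇒¬Straddles (x ∷ τ) (inj₂ (_ , ext , _))   (refl ∷ p) b<M = extreme⇒¬Straddles ext p

Good⇒Avoids : ∀ {M} τ → Good M τ → Avoids τ
Good⇒Avoids (x ∷ τ) (inj₁ (_ , g))       (.x ∷⁻ p)  b<a = Good⇒Avoids τ g p b<a
Good⇒Avoids (x ∷ τ) (inj₂ (_ , _ , g))   (.x ∷⁻ p)  b<a = Good⇒Avoids τ g p b<a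
Good⇒Avoids (x ∷ τ) (inj₁ (_ , g))       (refl ∷ p) b<a = Good⇒¬Straddles τ g p b<a
Good⇒Avoids (x ∷ τ) (inj₂ (x<M , _ , g)) (refl ∷ p) b<a = Good⇒¬Straddles τ g p (<-trans b<a x<M)

∈-pair⇒⊆ : ∀ {c d : ℕ} {τ} → c ∈ τ → d ∈ τ → c ≢ d → (c ∷ d ∷ []) ⊆ τ ⊎ (d ∷ c ∷ []) ⊆ τ
∈-pair⇒⊆ (here refl) (here refl) c≢d = contradiction refl c≢d
∈-pair⇒⊆ (here refl) (there j)   c≢d = inj₁ (refl ∷ from∈ j)
∈-pair⇒⊆ (there i)   (here refl) c≢d = inj₂ (refl ∷ from∈ i)
∈-pair⇒⊆ (there i)   (there j)   c≢d = Sum.map (_ ∷⁻_) (_ ∷⁻_) (∈-pair⇒⊆ i j c≢d)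

-- Keeping the running maximum in front of the list lets it play the `a` of every pattern: a new
-- maximum replaces it, and any other entry is deleted from behind it.
Avoids⇒Good : ∀ M τ → Unique (M ∷ τ) → Avoids (M ∷ τ) → Good M τ
Avoids⇒Good M []      _ _ = tt
Avoids⇒Good M (x ∷ τ) ((M≢x ∷ M≢τ) ∷ x≢τ ∷ uτ) av with <-cmp M x
... | tri< M<x _ _ = inj₁ (M<x , Avoids⇒Good x τ (x≢τ ∷ uτ) (av ∘ (M ∷⁻_)))
... | tri≈ _ M≡x _ = contradiction M≡x M≢x
... | tri> _ _ x<M = inj₂ (x<M , extreme , Avoids⇒Good M τ (M≢τ ∷ uτ) (av ∘ skip-second))
  where
  skip-second : ∀ {s} → s ⊆ M ∷ τ → s ⊆ M ∷ x ∷ τ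
  skip-second (refl ∷ p) = refl ∷ x ∷⁻ p
  skip-second (.M ∷⁻ p)  = M ∷⁻ x ∷⁻ p

  extreme : All (x <_) τ ⊎ All (_< x) τ
  extreme with All.all? (x <?_) τ | All.all? (_<? x) τ
  ... | yes lo | _      = inj₁ lo
  ... | no _   | yes hi = inj₂ hi
  ... | no ¬lo | no ¬hi
    with c , c∈ , x≮c ← find (¬All⇒Any¬ (x <?_) τ ¬lo)
    with d , d∈ , d≮x ← find (¬All⇒Any¬ (_<? x) τ ¬hi)
    with c<x ← ≤∧≢⇒< (≮⇒≥ x≮c) (All.lookup x≢τ c∈ ∘ sym)
    with x<d ← ≤∧≢⇒< (≮⇒≥ d≮x) (All.lookup x≢τ d∈)
    with ∈-pair⇒⊆ c∈ d∈ (<⇒≢ (<-trans c<x x<d))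
  ... | inj₁ p = ⊥-elim (av (refl ∷ refl ∷ p) x<M (low-high c<x x<d))
  ... | inj₂ p = ⊥-elim (av (refl ∷ refl ∷ p) x<M (high-low c<x x<d))

Avoids⇒Good₀ : ∀ σ → Unique σ → All (0 <_) σ → Avoids σ → Good 0 σ
Avoids⇒Good₀ σ u pos av = Avoids⇒Good 0 σ (All.map <⇒≢ pos ∷ u) λ where
  (.0 ∷⁻ p)  → av p
  -- The fictitious 0 in the role of `a` would require `b < 0`.
  (refl ∷ p) → λ ()

-- Generating the permutations entry by entry

Sorted : List ℕ → Set
Sorted = AllPairs _<_

Sorted-++⁻ : ∀ xs {ys} → Sorted (xs ++ ys) → Sorted xs × Sorted ys × All (λ x → All (x <_) ys) xs
Sorted-++⁻ []       rs       = [] , rs , []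
Sorted-++⁻ (x ∷ xs) (r ∷ rs) with Sorted-++⁻ xs rs
... | rxs , rys , rxy = AllP.++⁻ˡ xs r ∷ rxs , rys , AllP.++⁻ʳ xs r ∷ rxy

-- Here and in `front` a nonempty list is given by head and tail, so that the last entry always
-- exists.
final : ℕ → List ℕ → ℕ
final x []      = x
final x (y ∷ W) = final y W

front : ℕ → List ℕ → List ℕ
front x []      = []
front x (y ∷ W) = x ∷ front y W

front∷ʳfinal : ∀ x W → front x W ∷ʳ final x W ≡ x ∷ W
front∷ʳfinal x []      = refl
front∷ʳfinal x (y ∷ W) = cong (x ∷_) (front∷ʳfinal y W)

length-front : ∀ x W → length (front x W) ≡ length W
length-front x []      = refl
length-front x (y ∷ W) = cong suc (length-front y W)

front-sorted : ∀ x W → Sorted (x ∷ W) → Sorted (front x W) × All (_< final x W) (front x W)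
front-sorted x W s with Sorted-++⁻ (front x W) (subst Sorted (sym (front∷ʳfinal x W)) s)
... | sf , _ , lt = sf , All.map All.head lt

final∷front : ∀ x W → final x W ∷ front x W ↭ x ∷ W
final∷front x W = ↭-trans (∷↭∷ʳ (final x W) (front x W)) (↭-reflexive (front∷ʳfinal x W))

-- Arrangements of the entries after the maximum

MinMax : List ℕ → Set
MinMax []      = ⊤
MinMax (x ∷ τ) = (All (x <_) τ ⊎ All (_< x) τ) × MinMax τ

-- Here V is ascending of length k + 1, so that its ends are its extreme elements.
arr : ℕ → List ℕ → List (List ℕ)
arr zero    V       = V ∷ []
arr (suc k) []      = []
arr (suc k) (x ∷ W) = map (x ∷_) (arr k W) ++ map (final x W ∷_) (arr k (front x W))

arrangements : List ℕ → List (List ℕ)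
arrangements []      = [] ∷ []
arrangements (x ∷ W) = arr (length W) (x ∷ W)

arr-sound : ∀ k V → Sorted V → length V ≡ suc k → ∀ {τ} → τ ∈ arr k V → τ ↭ V × MinMax τ
arr-sound zero    (x ∷ [])    _ _ (here refl) = ↭-refl , inj₁ [] , tt
arr-sound (suc k) (x ∷ W) (x<W ∷ s) len i with ∈-++⁻ (map (x ∷_) (arr k W)) i
... | inj₁ j
  with _ , j′ , refl ← ∈-map⁻ (x ∷_) j
  with p , mm ← arr-sound k W s (suc-injective len) j′
  = prep x p , inj₁ (All-resp-↭ (↭-sym p) x<W) , mm
... | inj₂ j
  with _ , j′ , refl ← ∈-map⁻ (final x W ∷_) j
  with sf , lt ← front-sorted x W (x<W ∷ s)
  with p , mm ← arr-sound k (front x W) sf (trans (length-front x W) (suc-injective len)) j′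
  = ↭-trans (prep _ p) (final∷front x W) , inj₂ (All-resp-↭ (↭-sym p) lt) , mm

-- If the heads differed, each would occur in the other's tail, and each would precede the other.
-- The relation is a parameter so that one proof serves smallest entries and, through `flip`,
-- largest ones.
least-unique : ∀ {_≺_ : Rel ℕ 0ℓ} → Asymmetric _≺_ → ∀ {x y V W} →
               All (x ≺_) V → All (y ≺_) W → x ∷ V ↭ y ∷ W → x ≡ y
least-unique asym x≺V y≺W p with ∈-resp-↭ p (here refl) | ∈-resp-↭ (↭-sym p) (here refl)
... | here x≡y | _         = x≡y
... | there _  | here y≡x  = sym y≡x
... | there i  | there j   = contradiction (All.lookup x≺V j) (asym (All.lookup y≺W i))

arr-complete : ∀ k V → Sorted V → length V ≡ suc k → ∀ {τ} → τ ↭ V → MinMax τ → τ ∈ arr k V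
arr-complete zero    (x ∷ [])    _ _ p _ = here (↭-singleton-inv p)
arr-complete (suc k) (x ∷ W) _ _ {[]} p _ = contradiction (↭-sym p) ¬x∷xs↭[]
arr-complete (suc k) (x ∷ W) (x<W ∷ s) len {y ∷ τ} p (inj₁ lo , mm)
  with refl ← least-unique <-asym lo x<W p
  = ∈-++⁺ˡ (∈-map⁺ (x ∷_) (arr-complete k W s (suc-injective len) (drop-∷ p) mm))
arr-complete (suc k) (x ∷ W) s len {y ∷ τ} p (inj₂ hi , mm)
  with sf , lt ← front-sorted x W s
  with p′ ← ↭-trans p (↭-sym (final∷front x W))
  with refl ← least-unique (flip <-asym) hi lt p′
  = ∈-++⁺ʳ (map (x ∷_) (arr k W))
      (∈-map⁺ (final x W ∷_) (arr-complete k (front x W) sf (trans (length-front x W) (suc-injective len)) (drop-∷ p′) mm))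

final-> : ∀ x y W → Sorted (x ∷ y ∷ W) → x < final y W
final-> x y []      ((x<y ∷ _) ∷ _) = x<y
final-> x y (z ∷ W) ((x<y ∷ _) ∷ s) = <-trans x<y (final-> y z W s)

Unique-map-∷ : ∀ (x : ℕ) {xss} → Unique xss → Unique (map (x ∷_) xss)
Unique-map-∷ x = Uniq.map⁺ ∷-injectiveʳ

-- With two or more values left, the smallest and the largest differ, so the two branches differ in
-- their first entry. A single value is both at once, and the base case lists it only once.
arr-unique : ∀ k V → Sorted V → length V ≡ suc k → Unique (arr k V)
arr-unique zero    V           _ _   = [] ∷ []
arr-unique (suc k) (x ∷ y ∷ W) s@(_ ∷ s′) len = Uniq.++⁺
  (Unique-map-∷ x (arr-unique k (y ∷ W) s′ (suc-injective len)))
  (Unique-map-∷ _ (arr-unique k (front x (y ∷ W)) (proj₁ (front-sorted x (y ∷ W) s))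
                              (trans (length-front x (y ∷ W)) (suc-injective len))))
  λ (i , j) → different (∈-map⁻ (x ∷_) i) (∈-map⁻ (final y W ∷_) j)
  where
  different : ∀ {τ} → ∃[ α ] α ∈ arr k (y ∷ W) × τ ≡ x ∷ α →
              ∃[ β ] β ∈ arr k (front x (y ∷ W)) × τ ≡ final y W ∷ β → ⊥
  different (_ , _ , refl) (_ , _ , eq) = <⇒≢ (final-> x y W s) (∷-injectiveˡ eq)

arr-length : ∀ k V → length V ≡ suc k → length (arr k V) ≡ 2 ^ k
arr-length zero    V       _   = refl
arr-length (suc k) (x ∷ W) len = begin
  length (map (x ∷_) (arr k W) ++ map (final x W ∷_) (arr k (front x W)))
    ≡⟨ length-++ (map (x ∷_) (arr k W)) ⟩
  length (map (x ∷_) (arr k W)) + length (map (final x W ∷_) (arr k (front x W)))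
    ≡⟨ cong₂ _+_ (trans (length-map (x ∷_) (arr k W)) (arr-length k W (suc-injective len)))
                 (trans (length-map (final x W ∷_) (arr k (front x W))) (arr-length k (front x W) (trans (length-front x W) (suc-injective len)))) ⟩
  2 ^ k + 2 ^ k
    ≡⟨ cong (2 ^ k +_) (+-identityʳ (2 ^ k)) ⟨
  2 ^ suc k ∎
  where open ≡-Reasoning

arrangements-sound : ∀ V → Sorted V → ∀ {τ} → τ ∈ arrangements V → τ ↭ V × MinMax τ
arrangements-sound []      _ (here refl) = ↭-refl , tt
arrangements-sound (x ∷ W) s i           = arr-sound (length W) (x ∷ W) s refl i

arrangements-complete : ∀ V → Sorted V → ∀ {τ} → τ ↭ V → MinMax τ → τ ∈ arrangements V
arrangements-complete []      _ p mm = here (↭-empty-inv p)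
arrangements-complete (x ∷ W) s p mm = arr-complete (length W) (x ∷ W) s refl p mm

arrangements-unique : ∀ V → Sorted V → Unique (arrangements V)
arrangements-unique []      _ = [] ∷ []
arrangements-unique (x ∷ W) s = arr-unique (length W) (x ∷ W) s refl

betaCount : ℕ → ℕ
betaCount zero    = 1
betaCount (suc k) = 2 ^ k

arrangements-length : ∀ V → length (arrangements V) ≡ betaCount (length V)
arrangements-length []      = refl
arrangements-length (x ∷ W) = arr-length (length W) (x ∷ W) refl

-- Words on V ∪ U ∪ {n} that can follow a prefix whose largest entry lies between the ascending
-- lists V and U, with d entries and l left-to-right maxima before n.
mutual
  gen : ℕ → List ℕ → List ℕ → ℕ → ℕ → List (List ℕ)
  gen n V       U zero    zero    = map (n ∷_) (arrangements (V ++ U))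
  gen n V       U zero    (suc l) = []
  gen n []      U (suc d) l       = genUp n [] U d l
  gen n (v ∷ V) U (suc d) l       = map (v ∷_) (gen n V U d l) ++ genUp n (v ∷ V) U d l

  genUp : ℕ → List ℕ → List ℕ → ℕ → ℕ → List (List ℕ)
  genUp n V []      d l       = []
  genUp n V (u ∷ U) d zero    = []
  -- Choosing `u` is an up-step followed at once by a down-step, a peak, and costs one unit of `l`.
  -- Passing over `u` is an up-step alone: `u` will lie below the next maximum, and appending it
  -- keeps `V` ascending.
  genUp n V (u ∷ U) d (suc l) = map (u ∷_) (gen n V U d l) ++ genUp n (V ∷ʳ u) U d (suc l)

length-∷ʳ : ∀ {A : Set} (xs : List A) x → length (xs ∷ʳ x) ≡ suc (length xs)
length-∷ʳ xs x = trans (length-++ xs) (+-comm (length xs) 1)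

mutual
  -- `gen` and `genUp` branch exactly as `F` and `R` do, with `length U` as the up-steps left and
  -- `length V` as the height. The number of entries left for β, the argument of `betaCount`, is the
  -- same in every branch and so factors out.
  gen-length : ∀ n V U d l →
               length (gen n V U d l) ≡ betaCount (length V + length U ∸ d) * F d (length U) (length V) l
  gen-length n V U zero zero =
    trans (length-map _ (arrangements (V ++ U))) (trans (arrangements-length (V ++ U))
      (trans (cong betaCount (length-++ V)) (sym (*-identityʳ _))))
  gen-length n V U zero (suc l) = sym (*-zeroʳ (betaCount (length V + length U)))
  gen-length n []      U (suc d) l = genUp-length n [] U d l
  gen-length n (v ∷ V) U (suc d) l = begin
    length (map (v ∷_) (gen n V U d l) ++ genUp n (v ∷ V) U d l)
      ≡⟨ length-++ (map (v ∷_) (gen n V U d l)) ⟩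
    length (map (v ∷_) (gen n V U d l)) + length (genUp n (v ∷ V) U d l)
      ≡⟨ cong₂ _+_ (trans (length-map _ (gen n V U d l)) (gen-length n V U d l)) (genUp-length n (v ∷ V) U d l) ⟩
    betaCount (length V + length U ∸ d) * F d (length U) (length V) l
      + betaCount (length V + length U ∸ d) * R d (length U) (suc (length V)) l
      ≡⟨ *-distribˡ-+ (betaCount (length V + length U ∸ d)) (F d (length U) (length V) l) _ ⟨
    betaCount (length V + length U ∸ d) * (F d (length U) (length V) l + R d (length U) (suc (length V)) l) ∎
    where open ≡-Reasoning

  genUp-length : ∀ n V U d l →
                 length (genUp n V U d l) ≡ betaCount (length V + length U ∸ suc d) * R d (length U) (length V) l
  genUp-length n V []      d l       = sym (*-zeroʳ (betaCount (length V + 0 ∸ suc d)))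
  genUp-length n V (u ∷ U) d zero    = sym (*-zeroʳ (betaCount (length V + suc (length U) ∸ suc d)))
  genUp-length n V (u ∷ U) d (suc l) = begin
    length (map (u ∷_) (gen n V U d l) ++ genUp n (V ∷ʳ u) U d (suc l))
      ≡⟨ length-++ (map (u ∷_) (gen n V U d l)) ⟩
    length (map (u ∷_) (gen n V U d l)) + length (genUp n (V ∷ʳ u) U d (suc l))
      ≡⟨ cong₂ _+_ (trans (length-map _ (gen n V U d l)) (gen-length n V U d l))
                   (trans (genUp-length n (V ∷ʳ u) U d (suc l))
                          (cong (λ k → betaCount (k + length U ∸ suc d) * R d (length U) k (suc l)) (length-∷ʳ V u))) ⟩
    betaCount (length V + length U ∸ d) * F d (length U) (length V) l
      + betaCount (length V + length U ∸ d) * R d (length U) (suc (length V)) (suc l)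
      ≡⟨ *-distribˡ-+ (betaCount (length V + length U ∸ d)) (F d (length U) (length V) l) _ ⟨
    betaCount (suc (length V + length U) ∸ suc d) * (F d (length U) (length V) l + R d (length U) (suc (length V)) (suc l))
      ≡⟨ cong (λ k → betaCount (k ∸ suc d) * R d (suc (length U)) (length V) (suc l)) (+-suc (length V) (length U)) ⟨
    betaCount (length V + suc (length U) ∸ suc d) * R d (suc (length U)) (length V) (suc l) ∎
    where open ≡-Reasoning

genUp-head : ∀ n V U d l {τ} → τ ∈ genUp n V U d l → ∃[ x ] ∃[ α ] τ ≡ x ∷ α × x ∈ U
genUp-head n V (u ∷ U) d (suc l) i with ∈-++⁻ (map (u ∷_) (gen n V U d l)) i
... | inj₁ j with ∈-map⁻ (u ∷_) j
...   | α , _ , eq = u , α , eq , here refl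
genUp-head n V (u ∷ U) d (suc l) i | inj₂ j with genUp-head n (V ∷ʳ u) U d (suc l) j
...   | x , α , eq , x∈U = x , α , eq , there x∈U

Sorted-drop-mid : ∀ V {u U} → Sorted (V ++ u ∷ U) → Sorted (V ++ U)
Sorted-drop-mid []      (_ ∷ s) = s
Sorted-drop-mid (v ∷ V) (p ∷ s) = ++⁺ (AllP.++⁻ˡ V p) (All.tail (AllP.++⁻ʳ V p)) ∷ Sorted-drop-mid V s

mutual
  gen-unique : ∀ n V U d l → Sorted (V ++ U) → Unique (gen n V U d l)
  gen-unique n V       U zero    zero    s = Unique-map-∷ n (arrangements-unique (V ++ U) s)
  gen-unique n V       U zero    (suc l) s = []
  gen-unique n []      U (suc d) l       s = genUp-unique n [] U d l s
  gen-unique n (v ∷ V) U (suc d) l       s@(v< ∷ s′) = Uniq.++⁺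
    (Unique-map-∷ v (gen-unique n V U d l s′)) (genUp-unique n (v ∷ V) U d l s)
    λ (i , j) → different (∈-map⁻ (v ∷_) i) (genUp-head n (v ∷ V) U d l j)
    where
    different : ∀ {τ} → ∃[ α ] α ∈ gen n V U d l × τ ≡ v ∷ α → ∃[ x ] ∃[ α ] τ ≡ x ∷ α × x ∈ U → ⊥
    different (_ , _ , refl) (_ , _ , refl , v∈U) = <-irrefl refl (All.lookup (AllP.++⁻ʳ V v<) v∈U)

  genUp-unique : ∀ n V U d l → Sorted (V ++ U) → Unique (genUp n V U d l)
  genUp-unique n V []      d l       s = []
  genUp-unique n V (u ∷ U) d zero    s = []
  genUp-unique n V (u ∷ U) d (suc l) s = Uniq.++⁺
    (Unique-map-∷ u (gen-unique n V U d l (Sorted-drop-mid V s)))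
    (genUp-unique n (V ∷ʳ u) U d (suc l) (subst Sorted (sym (∷ʳ-++ V u U)) s))
    λ (i , j) → different (∈-map⁻ (u ∷_) i) (genUp-head n (V ∷ʳ u) U d (suc l) j)
    where
    different : ∀ {τ} → ∃[ α ] α ∈ gen n V U d l × τ ≡ u ∷ α → ∃[ x ] ∃[ α ] τ ≡ x ∷ α × x ∈ U → ⊥
    different (_ , _ , refl) (_ , _ , refl , u∈U) =
      <-irrefl refl (All.lookup (AllPairs.head (proj₁ (proj₂ (Sorted-++⁻ V s)))) u∈U)

-- Soundness and completeness of the enumeration

record Context (n M : ℕ) (V U : List ℕ) : Set where
  constructor context
  field
    sorted : Sorted (V ++ U)
    all<n  : All (_< n) (V ++ U)
    M<n    : M < n
    V<M    : All (_< M) V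
    M<U    : All (M <_) U
open Context

context-place : ∀ {n M v V U} → Context n M (v ∷ V) U → Context n M V U
context-place (context (_ ∷ s) (_ ∷ lt) M<n (_ ∷ V<M) M<U) = context s lt M<n V<M M<U

All-drop-mid : ∀ {P : ℕ → Set} V {u U} → All P (V ++ u ∷ U) → All P (V ++ U)
All-drop-mid V ps = ++⁺ (AllP.++⁻ˡ V ps) (All.tail (AllP.++⁻ʳ V ps))

context-pick : ∀ {n} V {u U} → Sorted (V ++ u ∷ U) → All (_< n) (V ++ u ∷ U) → Context n u V U
context-pick V s lt with Sorted-++⁻ V s
... | _ , u<U ∷ _ , V<uU =
  context (Sorted-drop-mid V s) (All-drop-mid V lt) (All.head (AllP.++⁻ʳ V lt)) (All.map All.head V<uU) u<U

indexOf-≡ : ∀ n τ → indexOf n (n ∷ τ) ≡ 1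
indexOf-≡ n τ rewrite Equivalence.to T-≡ (≡⇒≡ᵇ n n refl) = refl

indexOf-≢ : ∀ {n x} τ → n ≢ x → indexOf n (x ∷ τ) ≡ suc (indexOf n τ)
indexOf-≢ {n} {x} τ n≢x rewrite ¬-not (n≢x ∘ ≡ᵇ⇒≡ n x ∘ Equivalence.from T-≡) = refl

indexOf≢0 : ∀ n τ → indexOf n τ ≢ 0
indexOf≢0 n []      ()
indexOf≢0 n (x ∷ τ) eq with n ≡ᵇ x
indexOf≢0 n (x ∷ τ) () | true
indexOf≢0 n (x ∷ τ) () | false

lmaxFrom-up : ∀ {M x} τ → M < x → lmaxFrom M (x ∷ τ) ≡ suc (lmaxFrom x τ)
lmaxFrom-up τ M<x rewrite <⇒<ᵇ≡true M<x = refl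

lmaxFrom-down : ∀ {M x} τ → x < M → lmaxFrom M (x ∷ τ) ≡ lmaxFrom M τ
lmaxFrom-down τ x<M rewrite ≤⇒<ᵇ≡false (<⇒≤ x<M) = refl

lmaxFrom-bounded : ∀ {M τ} → All (_< M) τ → lmaxFrom M τ ≡ 0
lmaxFrom-bounded []                   = refl
lmaxFrom-bounded {τ = _ ∷ τ} (x<M ∷ ps) = trans (lmaxFrom-down τ x<M) (lmaxFrom-bounded ps)

lmaxFrom≢0 : ∀ {M n} τ → n ∈ τ → M < n → lmaxFrom M τ ≢ 0
lmaxFrom≢0 {M} (x ∷ τ) i M<n eq with M <ᵇ x in M<x
lmaxFrom≢0     (x ∷ τ) (here refl) M<n eq | false with trans (sym (<⇒<ᵇ≡true M<n)) M<x
... | ()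
lmaxFrom≢0     (x ∷ τ) (there i)   M<n eq | false = lmaxFrom≢0 τ i M<n eq

MinMax⇒Good : ∀ {M τ} → All (_< M) τ → MinMax τ → Good M τ
MinMax⇒Good []         mm         = tt
MinMax⇒Good (x<M ∷ lt) (ext , mm) = inj₂ (x<M , ext , MinMax⇒Good lt mm)

Good⇒MinMax : ∀ {M τ} → All (_< M) τ → Good M τ → MinMax τ
Good⇒MinMax []         g                    = tt
Good⇒MinMax (x<M ∷ lt) (inj₁ (M<x , _))     = contradiction M<x (<-asym x<M)
Good⇒MinMax (x<M ∷ lt) (inj₂ (_ , ext , g)) = ext , Good⇒MinMax lt g

record Continues (n M : ℕ) (τ : List ℕ) (d l : ℕ) : Set where
  constructor continues
  field
    good  : Good M τ
    index : indexOf n τ ≡ suc d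
    maxima : lmaxFrom M τ ≡ suc l

insert-U : ∀ n {u : ℕ} V U → u ∷ n ∷ V ++ U ↭ n ∷ V ++ u ∷ U
insert-U n {u} V U = ↭-trans (↭-swap u n ↭-refl) (↭-prep n (↭-sym (shift u V U)))

mutual
  gen-sound : ∀ {n M} V U d l → Context n M V U → ∀ {τ} → τ ∈ gen n V U d l →
              τ ↭ n ∷ V ++ U × Continues n M τ d l
  gen-sound {n} {M} V U zero zero ctx i
    with β , j , refl ← ∈-map⁻ (n ∷_) i
    with p , mm ← arrangements-sound (V ++ U) (sorted ctx) j
    with lt ← All-resp-↭ (↭-sym p) (all<n ctx)
    = prep n p , continues (inj₁ (M<n ctx , MinMax⇒Good lt mm)) (indexOf-≡ n β)
                           (trans (lmaxFrom-up β (M<n ctx)) (cong suc (lmaxFrom-bounded lt)))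
  gen-sound []      U (suc d) l ctx i = genUp⇒continues [] U d l ctx i
  gen-sound {n} (v ∷ V) U (suc d) l ctx i with ∈-++⁻ (map (v ∷_) (gen n V U d l)) i
  ... | inj₂ j = genUp⇒continues (v ∷ V) U d l ctx j
  ... | inj₁ j
    with τ , k , refl ← ∈-map⁻ (v ∷_) j
    with p , continues g ix lm ← gen-sound V U d l (context-place ctx) k
    = ↭-trans (prep v p) (↭-swap v n ↭-refl) ,
      continues (inj₂ (All.head (V<M ctx) , inj₁ (All-resp-↭ (↭-sym p) v<) , g))
                (trans (indexOf-≢ τ (<⇒≢ v<n ∘ sym)) (cong suc ix))
                (trans (lmaxFrom-down τ (All.head (V<M ctx))) lm)
    where
    v<n = All.head (all<n ctx)
    v<  = v<n ∷ AllPairs.head (sorted ctx)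

  genUp⇒continues : ∀ {n M} V U d l → Context n M V U → ∀ {τ} → τ ∈ genUp n V U d l →
                    τ ↭ n ∷ V ++ U × Continues n M τ (suc d) l
  genUp⇒continues V U d l ctx i
    with x , τ , l′ , refl , refl , x∈U , p , continues g ix lm ← genUp-sound V U d l (sorted ctx) (all<n ctx) i
    with M<x ← All.lookup (M<U ctx) x∈U
    = p , continues (inj₁ (M<x , g))
                    (trans (indexOf-≢ τ (<⇒≢ (All.lookup (all<n ctx) (∈-++⁺ʳ V x∈U)) ∘ sym)) (cong suc ix))
                    (trans (lmaxFrom-up τ M<x) (cong suc lm))

  -- While values are being passed over, the old maximum no longer separates `V` from `U`, so no
  -- `Context` is available. Only order and the bound `n` are carried along, until the chosen `x`
  -- restores a context as the new maximum.
  genUp-sound : ∀ {n} V U d l → Sorted (V ++ U) → All (_< n) (V ++ U) → ∀ {σ} → σ ∈ genUp n V U d l →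
                ∃[ x ] ∃[ τ ] ∃[ l′ ] σ ≡ x ∷ τ × l ≡ suc l′ × x ∈ U × σ ↭ n ∷ V ++ U × Continues n x τ d l′
  genUp-sound {n} V (u ∷ U) d (suc l) s lt i with ∈-++⁻ (map (u ∷_) (gen n V U d l)) i
  ... | inj₁ j
    with τ , k , refl ← ∈-map⁻ (u ∷_) j
    with p , c ← gen-sound V U d l (context-pick V s lt) k
    = u , τ , l , refl , refl , here refl , ↭-trans (prep u p) (insert-U n V U) , c
  ... | inj₂ j
    with x , τ , l′ , σ≡ , l≡ , x∈U , p , c ← genUp-sound (V ∷ʳ u) U d (suc l)
           (subst Sorted (sym (∷ʳ-++ V u U)) s) (subst (All (_< n)) (sym (∷ʳ-++ V u U)) lt) j
    = x , τ , l′ , σ≡ , l≡ , there x∈U , subst (λ W → _ ↭ n ∷ W) (∷ʳ-++ V u U) p , c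

genUp⊆gen : ∀ n V U d l {τ} → τ ∈ genUp n V U d l → τ ∈ gen n V U (suc d) l
genUp⊆gen n []      U d l i = i
genUp⊆gen n (v ∷ V) U d l i = ∈-++⁺ʳ (map (v ∷_) (gen n V U d l)) i

mutual
  gen-complete : ∀ {n M} V U d l → Context n M V U → ∀ {τ} → τ ↭ n ∷ V ++ U → Continues n M τ d l →
                 τ ∈ gen n V U d l
  gen-complete V U d l ctx {[]} p c = contradiction (↭-sym p) ¬x∷xs↭[]
  gen-complete {n} {M} V U d l ctx {x ∷ τ} p c with n ≟ x
  gen-complete {n} V U (suc d) l ctx {n ∷ τ} p (continues _ ix _) | yes refl
    with () ← trans (sym (indexOf-≡ n τ)) ix
  gen-complete {n} V U zero l ctx {n ∷ τ} p (continues (inj₂ (n<M , _)) _ _) | yes refl =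
    contradiction n<M (<-asym (M<n ctx))
  gen-complete {n} V U zero l ctx {n ∷ τ} p (continues (inj₁ (_ , g)) _ lm) | yes refl
    with q ← drop-∷ p
    with lt ← All-resp-↭ (↭-sym q) (all<n ctx)
    with refl ← trans (sym (suc-injective (trans (sym (lmaxFrom-up τ (M<n ctx))) lm))) (lmaxFrom-bounded lt)
    = ∈-map⁺ (n ∷_) (arrangements-complete (V ++ U) (sorted ctx) q (Good⇒MinMax lt g))
  gen-complete {n} V U zero l ctx {x ∷ τ} p (continues _ ix _) | no n≢x =
    contradiction (suc-injective (trans (sym (indexOf-≢ τ n≢x)) ix)) (indexOf≢0 n τ)
  gen-complete {n} V U (suc d) l ctx {x ∷ τ} p (continues g ix lm) | no n≢x
    with ix′ ← suc-injective (trans (sym (indexOf-≢ τ n≢x)) ix)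
    with ∈-resp-↭ p (here refl) | ∈-resp-↭ (↭-sym p) (here refl)
  ... | here refl | _         = contradiction refl n≢x
  ... | there _   | here n≡x  = contradiction n≡x n≢x
  ... | there i   | there n∈τ with ∈-++⁻ V i
  gen-complete {n} V U (suc d) l ctx {x ∷ τ} p (continues (inj₁ (M<x , g)) ix lm) | no n≢x | there i | there n∈τ | inj₂ x∈U =
    genUp⊆gen n V U d l (genUp-complete V U d l (sorted ctx) (all<n ctx) x∈U p n∈τ g ix′
      (suc-injective (trans (sym (lmaxFrom-up τ M<x)) lm)))
  gen-complete {n} V U (suc d) l ctx {x ∷ τ} p (continues (inj₂ (x<M , _)) ix lm) | no n≢x | there i | there n∈τ | inj₂ x∈U =
    contradiction x<M (<-asym (All.lookup (M<U ctx) x∈U))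
  gen-complete {n} V U (suc d) l ctx {x ∷ τ} p (continues (inj₁ (M<x , _)) ix lm) | no n≢x | there i | there n∈τ | inj₁ x∈V =
    contradiction M<x (<-asym (All.lookup (V<M ctx) x∈V))
  -- The entry `n` is still to come, so `x` is not the largest of what remains.
  gen-complete {n} V U (suc d) l ctx {x ∷ τ} p (continues (inj₂ (_ , inj₂ hi , _)) ix lm) | no n≢x | there i | there n∈τ | inj₁ x∈V =
    contradiction (All.lookup hi n∈τ) (<-asym (All.lookup (all<n ctx) i))
  gen-complete {n} (v ∷ V) U (suc d) l ctx {x ∷ τ} p (continues (inj₂ (x<M , inj₁ lo , g)) ix lm) | no n≢x | there i | there n∈τ | inj₁ x∈V
    with refl ← least-unique <-asym lo (All.head (all<n ctx) ∷ AllPairs.head (sorted ctx))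
                  (↭-trans p (↭-swap n v ↭-refl))
    = ∈-++⁺ˡ (∈-map⁺ (v ∷_) (gen-complete V U d l (context-place ctx) (drop-mid [] (n ∷ []) p)
        (continues g ix′ (trans (sym (lmaxFrom-down τ x<M)) lm))))

  -- The index `l` counts `x` but not `n`, while `lmaxFrom x τ` counts `n` but not `x`; so the two
  -- agree without a shift, and `l = 0` is impossible.
  genUp-complete : ∀ {n} V U d l → Sorted (V ++ U) → All (_< n) (V ++ U) → ∀ {x τ} → x ∈ U →
                   x ∷ τ ↭ n ∷ V ++ U → n ∈ τ → Good x τ → indexOf n τ ≡ suc d → lmaxFrom x τ ≡ l →
                   x ∷ τ ∈ genUp n V U d l
  genUp-complete V U d zero s lt {x} {τ} x∈U p n∈τ g ix lm =
    contradiction lm (lmaxFrom≢0 τ n∈τ (All.lookup lt (∈-++⁺ʳ V x∈U)))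
  genUp-complete {n} V (u ∷ U) d (suc l) s lt (here refl) p n∈τ g ix lm =
    ∈-++⁺ˡ (∈-map⁺ (u ∷_) (gen-complete V U d l (context-pick V s lt)
      (drop-∷ (↭-trans p (↭-sym (insert-U n V U)))) (continues g ix lm)))
  genUp-complete {n} V (u ∷ U) d (suc l) s lt (there x∈U) p n∈τ g ix lm =
    ∈-++⁺ʳ (map (u ∷_) (gen n V U d l))
      (genUp-complete (V ∷ʳ u) U d (suc l) (subst Sorted (sym (∷ʳ-++ V u U)) s)
        (subst (All (_< n)) (sym (∷ʳ-++ V u U)) lt) x∈U
        (subst (λ W → _ ↭ n ∷ W) (sym (∷ʳ-++ V u U)) p) n∈τ g ix lm)

-- The coefficients of J and B

∈-filterᵇ⁺ : ∀ {A : Set} (p : A → Bool) {xs x} → x ∈ xs → p x ≡ true → x ∈ filterᵇ p xs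
∈-filterᵇ⁺ p {x ∷ _} (here refl) px rewrite px = here refl
∈-filterᵇ⁺ p {y ∷ _} (there i)   px with p y
... | true  = there (∈-filterᵇ⁺ p i px)
... | false = ∈-filterᵇ⁺ p i px

∈-filterᵇ⁻ : ∀ {A : Set} (p : A → Bool) xs {x} → x ∈ filterᵇ p xs → x ∈ xs × p x ≡ true
∈-filterᵇ⁻ p (y ∷ xs) i with p y in py
∈-filterᵇ⁻ p (y ∷ xs) (here refl) | true  = here refl , py
∈-filterᵇ⁻ p (y ∷ xs) (there i)   | true  with ∈-filterᵇ⁻ p xs i
... | j , px = there j , px
∈-filterᵇ⁻ p (y ∷ xs) i           | false with ∈-filterᵇ⁻ p xs i
... | j , px = there j , px

filterᵇ-unique : ∀ {A : Set} (p : A → Bool) {xs} → Unique xs → Unique (filterᵇ p xs)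
filterᵇ-unique p {[]}     []       = []
filterᵇ-unique p {x ∷ xs} (u ∷ us) with p x
... | true  = All.tabulate (λ i → All.lookup u (proj₁ (∈-filterᵇ⁻ p xs i))) ∷ filterᵇ-unique p us
... | false = filterᵇ-unique p us

filterᵇ-cong : ∀ {A : Set} (p q : A → Bool) xs → (∀ {x} → x ∈ xs → p x ≡ q x) → filterᵇ p xs ≡ filterᵇ q xs
filterᵇ-cong p q []       eq = refl
filterᵇ-cong p q (x ∷ xs) eq rewrite eq (here refl) with q x
... | true  = cong (x ∷_) (filterᵇ-cong p q xs (eq ∘ there))
... | false = filterᵇ-cong p q xs (eq ∘ there)

filterᵇ-false : ∀ {A : Set} (xs : List A) → filterᵇ (λ _ → false) xs ≡ []
filterᵇ-false []       = refl
filterᵇ-false (x ∷ xs) = filterᵇ-false xs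

same-members⇒same-length : ∀ {A : Set} {xs ys : List A} → Unique xs → Unique ys →
                           (∀ {x} → x ∈ xs → x ∈ ys) → (∀ {x} → x ∈ ys → x ∈ xs) → length xs ≡ length ys
same-members⇒same-length u v f g = ↭-length (∼bag⇒↭ (unique∧set⇒bag u v (mk⇔ f g)))

-- Permutations as rearrangements of 1, ..., n

range : ℕ → List ℕ
range n = map suc (upTo n)

range-length : ∀ n → length (range n) ≡ n
range-length n = trans (length-map suc (upTo n)) (length-upTo n)

range-sorted : ∀ n → Sorted (range n)
range-sorted n = AllPairsP.map⁺ (AllPairsP.applyUpTo⁺₁ id n (λ i<j _ → s≤s i<j))

range-≤ : ∀ n → All (_≤ n) (range n)
range-≤ n = AllP.map⁺ (AllP.applyUpTo⁺₁ id n id)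

range-positive : ∀ n → All (0 <_) (range n)
range-positive n = AllP.map⁺ (AllP.applyUpTo⁺₂ id n (λ _ → z<s))

range-suc : ∀ n → range (suc n) ↭ suc n ∷ range n
range-suc n = ↭-trans (↭-reflexive (trans (cong (map suc) (sym (upTo-∷ʳ n))) (map-++ suc (upTo n) (n ∷ []))))
                      (↭-sym (∷↭∷ʳ (suc n) (range n)))

concatMap-map : ∀ {A B C : Set} (f : A → B → C) xs ys →
                concatMap (λ x → map (f x) ys) xs ≡ cartesianProductWith f xs ys
concatMap-map f []       ys = refl
concatMap-map f (x ∷ xs) ys = cong (map (f x) ys ++_) (concatMap-map f xs ys)

words-suc : ∀ n k → words n (suc k) ≡ cartesianProductWith (flip _∷_) (words n k) (range n)
words-suc n k = concatMap-map (flip _∷_) (words n k) (range n)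

words-unique : ∀ n k → Unique (words n k)
words-unique n zero    = [] ∷ []
words-unique n (suc k) = subst Unique (sym (words-suc n k))
  (Uniq.cartesianProductWith⁺ (flip _∷_) (λ eq → proj₂ (∷-injective eq) , proj₁ (∷-injective eq))
    (words-unique n k) (AllPairs.map <⇒≢ (range-sorted n)))

∈-words⁻ : ∀ n k {w} → w ∈ words n k → length w ≡ k × All (_∈ range n) w
∈-words⁻ n zero    (here refl) = refl , []
∈-words⁻ n (suc k) i
  with w , a , w∈ , a∈ , refl ← ∈-cartesianProductWith⁻ (flip _∷_) (words n k) (range n)
                                  (subst (_ ∈_) (words-suc n k) i)
  with len , all∈ ← ∈-words⁻ n k w∈
  = cong suc len , a∈ ∷ all∈

∈-words⁺ : ∀ n w → All (_∈ range n) w → w ∈ words n (length w)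
∈-words⁺ n []      []         = here refl
∈-words⁺ n (a ∷ w) (a∈ ∷ all∈) = subst (_ ∈_) (sym (words-suc n (length w)))
  (∈-cartesianProductWith⁺ (flip _∷_) (∈-words⁺ n w all∈) a∈)

elemᵇ⇒∈ : ∀ x ys → elemᵇ x ys ≡ true → x ∈ ys
elemᵇ⇒∈ x (y ∷ ys) eq with x ≡ᵇ y in x≡y
... | true  = here (≡ᵇ⇒≡ x y (Equivalence.from T-≡ x≡y))
... | false = there (elemᵇ⇒∈ x ys eq)

∈⇒elemᵇ : ∀ {x ys} → x ∈ ys → elemᵇ x ys ≡ true
∈⇒elemᵇ {x} (here refl) rewrite Equivalence.to T-≡ (≡⇒≡ᵇ x x refl) = refl
∈⇒elemᵇ {x} {y ∷ _} (there i) rewrite ∈⇒elemᵇ i with x ≡ᵇ y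
... | true  = refl
... | false = refl

distinctᵇ⇒Unique : ∀ xs → distinctᵇ xs ≡ true → Unique xs
distinctᵇ⇒Unique []       _  = []
distinctᵇ⇒Unique (x ∷ xs) eq with elemᵇ x xs in x∈
... | false = All.tabulate (λ { i refl → contradiction (trans (sym (∈⇒elemᵇ i)) x∈) λ () }) ∷ distinctᵇ⇒Unique xs eq

Unique⇒distinctᵇ : ∀ {xs} → Unique xs → distinctᵇ xs ≡ true
Unique⇒distinctᵇ {[]}     []       = refl
Unique⇒distinctᵇ {x ∷ xs} (u ∷ us) with elemᵇ x xs in x∈
... | true  = contradiction refl (All.lookup u (elemᵇ⇒∈ x xs x∈))
... | false = Unique⇒distinctᵇ us

-- The pigeonhole principle: each entry of `xs` uses up an occurrence in `ys`, and distinctness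
-- keeps the remaining entries inside what is left.
Unique∧⊆⇒↭ : ∀ {A : Set} {xs ys : List A} → Unique xs → All (_∈ ys) xs → length xs ≡ length ys → xs ↭ ys
Unique∧⊆⇒↭ {xs = []}     {[]} _ _ _ = ↭-refl
Unique∧⊆⇒↭ {xs = x ∷ xs} (x≢ ∷ u) (x∈ ∷ xs⊆) len
  with as , bs , refl ← ∈-∃++ x∈
  = ↭-trans (prep x (Unique∧⊆⇒↭ u (All.zipWith remove (x≢ , xs⊆)) (suc-injective (trans len (↭-length (shift x as bs))))))
            (↭-sym (shift x as bs))
  where
  remove : ∀ {z} → x ≢ z × z ∈ as ++ x ∷ bs → z ∈ as ++ bs
  remove (x≢z , i) with ∈-++⁻ as i
  ... | inj₁ j          = ∈-++⁺ˡ j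
  ... | inj₂ (here z≡x) = contradiction (sym z≡x) x≢z
  ... | inj₂ (there j)  = ∈-++⁺ʳ as j

Unique-resp-↭ : ∀ {xs ys : List ℕ} → xs ↭ ys → Unique xs → Unique ys
Unique-resp-↭ p = ↭ₛ.Unique-resp-↭ (setoid ℕ) (↭⇒↭ₛ p)

perms-unique : ∀ n → Unique (perms n)
perms-unique n = filterᵇ-unique distinctᵇ (words-unique n n)

∈-perms⁻ : ∀ n {σ} → σ ∈ perms n → σ ↭ range n
∈-perms⁻ n i with ∈-filterᵇ⁻ distinctᵇ (words n n) i
... | j , distinct with ∈-words⁻ n n j
... | len , all∈ = Unique∧⊆⇒↭ (distinctᵇ⇒Unique _ distinct) all∈ (trans len (sym (range-length n)))

∈-perms⁺ : ∀ n {σ} → σ ↭ range n → σ ∈ perms n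
∈-perms⁺ n {σ} p = ∈-filterᵇ⁺ distinctᵇ
  (subst (λ k → σ ∈ words n k) (trans (↭-length p) (range-length n)) (∈-words⁺ n σ (All.tabulate (∈-resp-↭ p))))
  (Unique⇒distinctᵇ (Unique-resp-↭ (↭-sym p) (AllPairs.map <⇒≢ (range-sorted n))))

module Perm {N σ} (p : σ ↭ range (suc N)) where
  unique : Unique σ
  unique = Unique-resp-↭ (↭-sym p) (AllPairs.map <⇒≢ (range-sorted (suc N)))

  positive : All (0 <_) σ
  positive = All-resp-↭ (↭-sym p) (range-positive (suc N))

  len : length σ ≡ suc N
  len = trans (↭-length p) (range-length (suc N))

  max∈ : suc N ∈ σ
  max∈ = ∈-resp-↭ (↭-sym (↭-trans p (range-suc N))) (here refl)

  max≡ : maxL σ ≡ suc N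
  max≡ = bounded (All-resp-↭ (↭-sym p) (range-≤ (suc N))) max∈
    where
    maxL-≤ : ∀ {τ} → All (_≤ suc N) τ → maxL τ ≤ suc N
    maxL-≤ []         = z≤n
    maxL-≤ (x≤ ∷ all≤) = ⊔-lub x≤ (maxL-≤ all≤)

    bounded : ∀ {τ} → All (_≤ suc N) τ → suc N ∈ τ → maxL τ ≡ suc N
    bounded (x≤ ∷ all≤) (here refl) = m≥n⇒m⊔n≡m (maxL-≤ all≤)
    bounded (x≤ ∷ all≤) (there i)   = trans (cong (_ ⊔_) (bounded all≤ i)) (m≤n⇒m⊔n≡n x≤)

  pos≡ : pos σ ≡ indexOf (suc N) σ
  pos≡ = cong (λ m → indexOf m σ) max≡

-- All values lie above the initial maximum 0, the one with which `lmax` starts; so no value is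
-- below it and the path begins at height 0.
context₀ : ∀ N → Context (suc N) 0 [] (range N)
context₀ N = context (range-sorted N) (All.map s≤s (range-≤ N)) z<s [] (range-positive N)

≡ᵇ≡true⇒≡ : ∀ {m n} → (m ≡ᵇ n) ≡ true → m ≡ n
≡ᵇ≡true⇒≡ eq = ≡ᵇ⇒≡ _ _ (Equivalence.from T-≡ eq)

≡⇒≡ᵇ≡true : ∀ {m n} → m ≡ n → (m ≡ᵇ n) ≡ true
≡⇒≡ᵇ≡true eq = Equivalence.to T-≡ (≡⇒≡ᵇ _ _ eq)

≢⇒≡ᵇ≡false : ∀ {m n} → m ≢ n → (m ≡ᵇ n) ≡ false
≢⇒≡ᵇ≡false m≢n = ¬-not (m≢n ∘ ≡ᵇ≡true⇒≡)

inJ : ℕ → ℕ → List ℕ → Bool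
inJ p l σ = avoidsT₁ᵇ σ ∧ (pos σ ≡ᵇ p) ∧ (lmax σ ≡ᵇ l)

module _ (N d l : ℕ) where
  private
    counted = filterᵇ (inJ (suc d) (suc l)) (perms (suc N))

    ⊆gen : ∀ {σ} → σ ∈ counted → σ ∈ gen (suc N) [] (range N) d l
    ⊆gen {σ} i
      with j , sel ← ∈-filterᵇ⁻ (inJ (suc d) (suc l)) (perms (suc N)) i
      with p ← ∈-perms⁻ (suc N) j
      with rest ← ∧-conicalʳ (avoidsT₁ᵇ σ) _ sel
      with unique ← Perm.unique p
      = gen-complete [] (range N) d l (context₀ N) (↭-trans p (range-suc N)) (continues
          (Avoids⇒Good₀ σ unique (Perm.positive p)
            (avoidsT₁ᵇ⇒Avoids σ unique (∧-conicalˡ (avoidsT₁ᵇ σ) _ sel)))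
          (trans (sym (Perm.pos≡ p)) (≡ᵇ≡true⇒≡ (∧-conicalˡ (pos σ ≡ᵇ suc d) _ rest)))
          (≡ᵇ≡true⇒≡ (∧-conicalʳ (pos σ ≡ᵇ suc d) _ rest)))

    gen⊆ : ∀ {σ} → σ ∈ gen (suc N) [] (range N) d l → σ ∈ counted
    gen⊆ {σ} i
      with q , continues good index maxima ← gen-sound [] (range N) d l (context₀ N) i
      with p ← ↭-trans q (↭-sym (range-suc N))
      = ∈-filterᵇ⁺ (inJ (suc d) (suc l)) (∈-perms⁺ (suc N) p)
          (cong₂ _∧_ (Avoids⇒avoidsT₁ᵇ σ (Good⇒Avoids σ good))
            (cong₂ _∧_ (≡⇒≡ᵇ≡true (trans (Perm.pos≡ p) index)) (≡⇒≡ᵇ≡true maxima)))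

  count-J : countᵇ (inJ (suc d) (suc l)) (perms (suc N)) ≡ betaCount (N ∸ d) * F d N 0 l
  count-J = begin
    length counted
      ≡⟨ same-members⇒same-length (filterᵇ-unique (inJ (suc d) (suc l)) (perms-unique (suc N)))
           (gen-unique (suc N) [] (range N) d l (range-sorted N)) ⊆gen gen⊆ ⟩
    length (gen (suc N) [] (range N) d l)
      ≡⟨ gen-length (suc N) [] (range N) d l ⟩
    betaCount (length (range N) ∸ d) * F d (length (range N)) 0 l
      ≡⟨ cong (λ n → betaCount (n ∸ d) * F d n 0 l) (range-length N) ⟩
    betaCount (N ∸ d) * F d N 0 l ∎
    where open ≡-Reasoning

-- The maximum comes after `d` entries and is itself a left-to-right maximum, which accounts for the
-- successors in the second and third index.
J-suc : ∀ N d l → J (suc N) (suc d) (suc l) ≡ ofℕ (betaCount (N ∸ d) * F d N 0 l)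
J-suc N d l = cong ofℕ (count-J N d l)

countᵇ-none : ∀ {A : Set} (p : A → Bool) xs → (∀ {x} → x ∈ xs → p x ≡ false) → countᵇ p xs ≡ 0
countᵇ-none p xs none = cong length (trans (filterᵇ-cong p (λ _ → false) xs none) (filterᵇ-false xs))

J-pos0 : ∀ n l → J n 0 l ≡ 0ℤ
J-pos0 zero    l = refl
J-pos0 (suc N) l = cong ofℕ (countᵇ-none (inJ 0 l) (perms (suc N)) λ {σ} _ →
  trans (cong (λ b → avoidsT₁ᵇ σ ∧ b ∧ (lmax σ ≡ᵇ l)) (≢⇒≡ᵇ≡false (indexOf≢0 (maxL σ) σ)))
        (∧-zeroʳ (avoidsT₁ᵇ σ)))

J-lmax0 : ∀ n p → J n p 0 ≡ 0ℤ
J-lmax0 zero    p = refl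
J-lmax0 (suc N) p = cong ofℕ (countᵇ-none (inJ p 0) (perms (suc N)) λ {σ} i →
  trans (cong (λ b → avoidsT₁ᵇ σ ∧ (pos σ ≡ᵇ p) ∧ b) (≢⇒≡ᵇ≡false (lmaxFrom≢0 σ (Perm.max∈ (∈-perms⁻ (suc N) i)) z<s)))
        (trans (cong (avoidsT₁ᵇ σ ∧_) (∧-zeroʳ (pos σ ≡ᵇ p))) (∧-zeroʳ (avoidsT₁ᵇ σ))))

lastIsᵇ⇒∈ : ∀ n τ → lastIsᵇ n τ ≡ true → n ∈ τ
lastIsᵇ⇒∈ n (x ∷ [])    eq = here (≡ᵇ≡true⇒≡ eq)
lastIsᵇ⇒∈ n (x ∷ y ∷ τ) eq = there (lastIsᵇ⇒∈ n (y ∷ τ) eq)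

lastIsᵇ≡indexOf : ∀ n τ → Unique τ → n ∈ τ → lastIsᵇ n τ ≡ (indexOf n τ ≡ᵇ length τ)
lastIsᵇ≡indexOf n (x ∷ [])    _ (here refl) =
  trans (≡⇒≡ᵇ≡true {n} refl) (sym (≡⇒≡ᵇ≡true (indexOf-≡ n [])))
lastIsᵇ≡indexOf n (x ∷ y ∷ τ) (n≢ ∷ _) (here refl) =
  trans (¬-not λ eq → All.lookup n≢ (lastIsᵇ⇒∈ n (y ∷ τ) eq) refl)
        (sym (cong (_≡ᵇ suc (suc (length τ))) (indexOf-≡ n (y ∷ τ))))
lastIsᵇ≡indexOf n (x ∷ y ∷ τ) (x≢ ∷ u) (there i) =
  trans (lastIsᵇ≡indexOf n (y ∷ τ) u i)
        (sym (cong (_≡ᵇ suc (suc (length τ))) (indexOf-≢ (y ∷ τ) (All.lookup x≢ i ∘ sym))))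

lastIsᵇ≡pos : ∀ N {σ} → σ ∈ perms (suc N) → lastIsᵇ (suc N) σ ≡ (pos σ ≡ᵇ suc N)
lastIsᵇ≡pos N {σ} i = trans (lastIsᵇ≡indexOf (suc N) σ unique max∈) (cong₂ _≡ᵇ_ (sym pos≡) len)
  where open Perm (∈-perms⁻ (suc N) i)

inB : ℕ → ℕ → ℕ → List ℕ → Bool
inB n p l σ = avoidsT₁ᵇ σ ∧ lastIsᵇ n σ ∧ (pos σ ≡ᵇ p) ∧ (lmax σ ≡ᵇ l)

-- The condition σ(n) = n is the same as pos(σ) = n, so B is the part of J with equal exponents of x
-- and y.
B-diagonal : ∀ n l → B n n l ≡ J n n l
B-diagonal zero    l = refl
B-diagonal (suc N) l = cong (ofℕ ∘ length)
  (filterᵇ-cong (inB (suc N) (suc N) l) (inJ (suc N) l) (perms (suc N)) λ {σ} i →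
    cong (avoidsT₁ᵇ σ ∧_) (trans (cong (_∧ ((pos σ ≡ᵇ suc N) ∧ (lmax σ ≡ᵇ l))) (lastIsᵇ≡pos N i))
                                 (∧-absorb (pos σ ≡ᵇ suc N) _)))
  where
  ∧-absorb : ∀ b c → b ∧ b ∧ c ≡ b ∧ c
  ∧-absorb true  c = refl
  ∧-absorb false c = refl

B-off-diagonal : ∀ n p l → n ≢ p → B n p l ≡ 0ℤ
B-off-diagonal zero    p l n≢p = refl
B-off-diagonal (suc N) p l n≢p = cong ofℕ (countᵇ-none (inB (suc N) p l) (perms (suc N)) λ {σ} i →
  trans (cong (avoidsT₁ᵇ σ ∧_) (trans (cong (_∧ ((pos σ ≡ᵇ p) ∧ (lmax σ ≡ᵇ l))) (lastIsᵇ≡pos N i))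
                                      (disjoint (pos σ))))
        (∧-zeroʳ (avoidsT₁ᵇ σ)))
  where
  disjoint : ∀ k {b} → (k ≡ᵇ suc N) ∧ (k ≡ᵇ p) ∧ b ≡ false
  disjoint k with k ≡ᵇ suc N in k≡n | k ≡ᵇ p in k≡p
  ... | false | _     = refl
  ... | true  | false = refl
  ... | true  | true  = contradiction (trans (sym (≡ᵇ≡true⇒≡ k≡n)) (≡ᵇ≡true⇒≡ {k} k≡p)) n≢p

-- The product formula

sumTo-cong : ∀ n {f g : ℕ → ℤ} → (∀ a → a ≤ n → f a ≡ g a) → sumTo n f ≡ sumTo n g
sumTo-cong zero    eq = eq 0 z≤n
sumTo-cong (suc n) eq = cong₂ _+ᶻ_ (sumTo-cong n (λ a a≤n → eq a (m≤n⇒m≤1+n a≤n))) (eq (suc n) ≤-refl)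

sumTo-diag : ∀ n (h : ℕ → ℕ → ℤ) → sumTo n (λ a → h a (n ∸ a)) ≡ diag n h
sumTo-diag zero    h = refl
sumTo-diag (suc n) h = trans
  (cong₂ _+ᶻ_ (trans (sumTo-cong n (λ a a≤n → cong (h a) (+-∸-assoc 1 a≤n))) (sumTo-diag n (λ a b → h a (suc b))))
              (cong (h (suc n)) (n∸n≡0 n)))
  (sym (diag-last n h))

diag-at-0 : ∀ n (h : ℕ → ℕ → ℤ) → (∀ a b → h a (suc b) ≡ 0ℤ) → diag n h ≡ h n 0
diag-at-0 zero    h vanish = refl
diag-at-0 (suc n) h vanish =
  trans (diag-last n h) (trans (cong (_+ᶻ h (suc n) 0) (diag-0 n vanish)) (ℤP.+-identityˡ _))

diag-at-1 : ∀ n (h : ℕ → ℕ → ℤ) → (∀ a → h a 0 ≡ 0ℤ) → (∀ a b → h a (suc (suc b)) ≡ 0ℤ) →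
            diag (suc n) h ≡ h n 1
diag-at-1 n h vanish₀ vanish₂ =
  trans (diag-last n h) (trans (cong₂ _+ᶻ_ (diag-at-0 n _ vanish₂) (vanish₀ (suc n))) (ℤP.+-identityʳ _))

diag-trim : ∀ n (h : ℕ → ℕ → ℤ) → (∀ b → h 0 b ≡ 0ℤ) → (∀ a → h a 0 ≡ 0ℤ) →
            diag (suc (suc n)) h ≡ diag n (λ a b → h (suc a) (suc b))
diag-trim n h left right = begin
  h 0 (suc (suc n)) +ᶻ diag (suc n) (h ∘ suc)
    ≡⟨ cong₂ _+ᶻ_ (left _) (diag-last n (h ∘ suc)) ⟩
  0ℤ +ᶻ (diag n (λ a b → h (suc a) (suc b)) +ᶻ h (suc (suc n)) 0)
    ≡⟨ trans (ℤP.+-identityˡ _) (cong (diag n (λ a b → h (suc a) (suc b)) +ᶻ_) (right _)) ⟩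
  diag n (λ a b → h (suc a) (suc b)) +ᶻ 0ℤ
    ≡⟨ ℤP.+-identityʳ _ ⟩
  diag n (λ a b → h (suc a) (suc b)) ∎
  where open ≡-Reasoning

diag-1 : ∀ (h : ℕ → ℕ → ℤ) → (∀ b → h 0 b ≡ 0ℤ) → (∀ a → h a 0 ≡ 0ℤ) → diag 1 h ≡ 0ℤ
diag-1 h left right = cong₂ _+ᶻ_ (left 1) (right 1)

-- Cauchy products in three variables

diag₃ : ℕ → ℕ → ℕ → (ℕ → ℕ → ℕ → ℕ → ℕ → ℕ → ℤ) → ℤ
diag₃ n p l h = diag n (λ a a′ → diag p (λ b b′ → diag l (λ c c′ → h a b c a′ b′ c′)))

sum-l : FPS3 → FPS3 → ℕ → ℕ → ℕ → ℕ → ℕ → ℤ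
sum-l G H l a b a′ b′ = diag l (λ c c′ → G a b c *ᶻ H a′ b′ c′)

sum-pl : FPS3 → FPS3 → ℕ → ℕ → ℕ → ℕ → ℤ
sum-pl G H p l a a′ = diag p (λ b b′ → sum-l G H l a b a′ b′)

⊛-diag₃ : ∀ (G H : FPS3) n p l → (G ⊛ H) n p l ≡ diag₃ n p l (λ a b c a′ b′ c′ → G a b c *ᶻ H a′ b′ c′)
⊛-diag₃ G H n p l = trans (sumTo-cong n λ a _ → trans (sumTo-cong p λ b _ →
    sumTo-diag l (λ c c′ → G a b c *ᶻ H (n ∸ a) (p ∸ b) c′))
    (sumTo-diag p (λ b b′ → sum-l G H l a b (n ∸ a) b′)))
    (sumTo-diag n (sum-pl G H p l))

diag₃-cong : ∀ n p l {h k} → (∀ a b c a′ b′ c′ → h a b c a′ b′ c′ ≡ k a b c a′ b′ c′) → diag₃ n p l h ≡ diag₃ n p l k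
diag₃-cong n p l eq = diag-cong n λ a a′ → diag-cong p λ b b′ → diag-cong l λ c c′ → eq a b c a′ b′ c′

diag₃-+ : ∀ n p l h k → diag₃ n p l (λ a b c a′ b′ c′ → h a b c a′ b′ c′ +ᶻ k a b c a′ b′ c′)
          ≡ diag₃ n p l h +ᶻ diag₃ n p l k
diag₃-+ n p l h k = trans (diag-cong n λ a a′ → trans (diag-cong p λ b b′ → diag-+ l _ _) (diag-+ p _ _)) (diag-+ n _ _)

diag₃-neg : ∀ n p l h → diag₃ n p l (λ a b c a′ b′ c′ → -ᶻ h a b c a′ b′ c′) ≡ -ᶻ diag₃ n p l h
diag₃-neg n p l h = trans (diag-cong n λ a a′ → trans (diag-cong p λ b b′ → diag-neg l _) (diag-neg p _)) (diag-neg n _)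

⊛-distribˡ-⊕ : ∀ (G H K : FPS3) n p l → (G ⊛ (H ⊕ K)) n p l ≡ (G ⊛ H) n p l +ᶻ (G ⊛ K) n p l
⊛-distribˡ-⊕ G H K n p l = begin
  (G ⊛ (H ⊕ K)) n p l
    ≡⟨ ⊛-diag₃ G (H ⊕ K) n p l ⟩
  diag₃ n p l (λ a b c a′ b′ c′ → G a b c *ᶻ (H a′ b′ c′ +ᶻ K a′ b′ c′))
    ≡⟨ diag₃-cong n p l (λ a b c a′ b′ c′ → ℤP.*-distribˡ-+ (G a b c) (H a′ b′ c′) (K a′ b′ c′)) ⟩
  diag₃ n p l (λ a b c a′ b′ c′ → G a b c *ᶻ H a′ b′ c′ +ᶻ G a b c *ᶻ K a′ b′ c′)
    ≡⟨ diag₃-+ n p l (λ a b c a′ b′ c′ → G a b c *ᶻ H a′ b′ c′) (λ a b c a′ b′ c′ → G a b c *ᶻ K a′ b′ c′) ⟩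
  _
    ≡⟨ cong₂ _+ᶻ_ (⊛-diag₃ G H n p l) (⊛-diag₃ G K n p l) ⟨
  (G ⊛ H) n p l +ᶻ (G ⊛ K) n p l ∎
  where open ≡-Reasoning

⊛-distribˡ-⊖ : ∀ (G H K : FPS3) n p l → (G ⊛ (H ⊖ K)) n p l ≡ (G ⊛ H) n p l ⊟ (G ⊛ K) n p l
⊛-distribˡ-⊖ G H K n p l = begin
  (G ⊛ (H ⊖ K)) n p l
    ≡⟨ ⊛-distribˡ-⊕ G H (λ a b c → -ᶻ K a b c) n p l ⟩
  (G ⊛ H) n p l +ᶻ (G ⊛ (λ a b c → -ᶻ K a b c)) n p l
    ≡⟨ cong ((G ⊛ H) n p l +ᶻ_) (trans (⊛-diag₃ G (λ a b c → -ᶻ K a b c) n p l)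
         (trans (diag₃-cong n p l (λ a b c a′ b′ c′ → sym (ℤP.neg-distribʳ-* (G a b c) (K a′ b′ c′))))
                (diag₃-neg n p l (λ a b c a′ b′ c′ → G a b c *ᶻ K a′ b′ c′)))) ⟩
  (G ⊛ H) n p l ⊟ diag₃ n p l (λ a b c a′ b′ c′ → G a b c *ᶻ K a′ b′ c′)
    ≡⟨ cong ((G ⊛ H) n p l ⊟_) (⊛-diag₃ G K n p l) ⟨
  (G ⊛ H) n p l ⊟ (G ⊛ K) n p l ∎
  where open ≡-Reasoning

⊛-yw : ∀ (G : FPS3) n p l → (G ⊛ yw) n (suc p) (suc l) ≡ G n p l
⊛-yw G n p l = begin
  (G ⊛ yw) n (suc p) (suc l)
    ≡⟨ ⊛-diag₃ G yw n (suc p) (suc l) ⟩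
  diag₃ n (suc p) (suc l) (λ a b c a′ b′ c′ → G a b c *ᶻ yw a′ b′ c′)
    ≡⟨ diag-at-0 n (sum-pl G yw (suc p) (suc l)) (λ a a′ → diag-0 (suc p) λ b b′ → diag-0 (suc l) λ c c′ → ℤP.*-zeroʳ (G a b c)) ⟩
  diag (suc p) (λ b b′ → diag (suc l) (λ c c′ → G n b c *ᶻ yw 0 b′ c′))
    ≡⟨ diag-at-1 p (λ b b′ → sum-l G yw (suc l) n b 0 b′)
                   (λ b → diag-0 (suc l) λ c c′ → ℤP.*-zeroʳ (G n b c))
                   (λ b b′ → diag-0 (suc l) λ c c′ → ℤP.*-zeroʳ (G n b c)) ⟩
  diag (suc l) (λ c c′ → G n p c *ᶻ yw 0 1 c′)
    ≡⟨ diag-at-1 l (λ c c′ → G n p c *ᶻ yw 0 1 c′) (λ c → ℤP.*-zeroʳ (G n p c)) (λ c c′ → ℤP.*-zeroʳ (G n p c)) ⟩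
  G n p l *ᶻ 1ℤ
    ≡⟨ ℤP.*-identityʳ _ ⟩
  G n p l ∎
  where open ≡-Reasoning

yw-pos0 : ∀ n l → yw n 0 l ≡ 0ℤ
yw-pos0 zero    l = refl
yw-pos0 (suc n) l = refl

yw-lmax0 : ∀ n p → yw n p 0 ≡ 0ℤ
yw-lmax0 zero    zero          = refl
yw-lmax0 zero    (suc zero)    = refl
yw-lmax0 zero    (suc (suc p)) = refl
yw-lmax0 (suc n) p             = refl

zero-*ˡ : ∀ {x} y → x ≡ 0ℤ → x *ᶻ y ≡ 0ℤ
zero-*ˡ y refl = refl

zero-*ʳ : ∀ x {y} → y ≡ 0ℤ → x *ᶻ y ≡ 0ℤ
zero-*ʳ x refl = ℤP.*-zeroʳ x

⊛-pos0 : ∀ (G H : FPS3) n l → (∀ n l → H n 0 l ≡ 0ℤ) → (G ⊛ H) n 0 l ≡ 0ℤ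
⊛-pos0 G H n l vanish = trans (⊛-diag₃ G H n 0 l)
  (diag-0 n λ a a′ → diag-0 l λ c c′ → zero-*ʳ (G a 0 c) (vanish a′ c′))

⊛-lmax0 : ∀ (G H : FPS3) n p → (∀ n p → H n p 0 ≡ 0ℤ) → (G ⊛ H) n p 0 ≡ 0ℤ
⊛-lmax0 G H n p vanish = trans (⊛-diag₃ G H n p 0)
  (diag-0 n λ a a′ → diag-0 p λ b b′ → zero-*ʳ (G a b 0) (vanish a′ b′))

-- Divisibility by the monomial xyw, stated coefficientwise. A product of two such series starts at
-- x²y²w², and `⊛-shift` rewrites it through coefficients at successor indices, the only ones with a
-- formula.
record xyw-Divisible (G : FPS3) : Set where
  field
    n0 : ∀ p l → G 0 p l ≡ 0ℤ
    p0 : ∀ n l → G n 0 l ≡ 0ℤ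
    l0 : ∀ n p → G n p 0 ≡ 0ℤ

module _ {G H : FPS3} (dG : xyw-Divisible G) (dH : xyw-Divisible H) where
  private
    module G = xyw-Divisible dG
    module H = xyw-Divisible dH

  ⊛-n1 : ∀ p l → (G ⊛ H) 1 p l ≡ 0ℤ
  ⊛-n1 p l = trans (⊛-diag₃ G H 1 p l) (diag-1 (sum-pl G H p l)
    (λ a′ → diag-0 p λ b b′ → diag-0 l λ c c′ → zero-*ˡ (H a′ b′ c′) (G.n0 b c))
    (λ a  → diag-0 p λ b b′ → diag-0 l λ c c′ → zero-*ʳ (G a b c) (H.n0 b′ c′)))

  ⊛-p1 : ∀ n l → (G ⊛ H) n 1 l ≡ 0ℤ
  ⊛-p1 n l = trans (⊛-diag₃ G H n 1 l) (diag-0 n λ a a′ → diag-1 (λ b b′ → sum-l G H l a b a′ b′)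
    (λ b′ → diag-0 l λ c c′ → zero-*ˡ (H a′ b′ c′) (G.p0 a c))
    (λ b  → diag-0 l λ c c′ → zero-*ʳ (G a b c) (H.p0 a′ c′)))

  ⊛-l1 : ∀ n p → (G ⊛ H) n p 1 ≡ 0ℤ
  ⊛-l1 n p = trans (⊛-diag₃ G H n p 1) (diag-0 n λ a a′ → diag-0 p λ b b′ → diag-1 (λ c c′ → G a b c *ᶻ H a′ b′ c′)
    (λ c′ → zero-*ˡ (H a′ b′ c′) (G.l0 a b))
    (λ c  → zero-*ʳ (G a b c) (H.l0 a′ b′)))

  ⊛-shift : ∀ n p l → (G ⊛ H) (suc (suc n)) (suc (suc p)) (suc (suc l))
            ≡ diag₃ n p l (λ a b c a′ b′ c′ → G (suc a) (suc b) (suc c) *ᶻ H (suc a′) (suc b′) (suc c′))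
  ⊛-shift n p l = trans (⊛-diag₃ G H (suc (suc n)) (suc (suc p)) (suc (suc l))) (trans
    (diag-trim n (sum-pl G H (suc (suc p)) (suc (suc l)))
      (λ a′ → diag-0 (suc (suc p)) λ b b′ → diag-0 (suc (suc l)) λ c c′ → zero-*ˡ (H a′ b′ c′) (G.n0 b c))
      (λ a  → diag-0 (suc (suc p)) λ b b′ → diag-0 (suc (suc l)) λ c c′ → zero-*ʳ (G a b c) (H.n0 b′ c′)))
    (diag-cong n λ a a′ → trans
      (diag-trim p (λ b b′ → sum-l G H (suc (suc l)) (suc a) b (suc a′) b′)
        (λ b′ → diag-0 (suc (suc l)) λ c c′ → zero-*ˡ (H (suc a′) b′ c′) (G.p0 (suc a) c))
        (λ b  → diag-0 (suc (suc l)) λ c c′ → zero-*ʳ (G (suc a) b c) (H.p0 (suc a′) c′)))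
      (diag-cong p λ b b′ → diag-trim l (λ c c′ → G (suc a) (suc b) c *ᶻ H (suc a′) (suc b′) c′)
        (λ c′ → zero-*ˡ (H (suc a′) (suc b′) c′) (G.l0 (suc a) (suc b)))
        (λ c  → zero-*ʳ (G (suc a) (suc b) c) (H.l0 (suc a′) (suc b′))))))

-- Products with a factor whose exponents of x and y agree

diag₂ : ℕ → ℕ → (ℕ → ℕ → ℕ → ℕ → ℤ) → ℤ
diag₂ n p h = diag n (λ a a′ → diag p (λ b b′ → h a b a′ b′))

Diagonal : (ℕ → ℕ → ℕ → ℕ → ℤ) → Set
Diagonal h = ∀ a b {a′ b′} → a′ ≢ b′ → h a b a′ b′ ≡ 0ℤ

Diagonal-suc : ∀ {h} → Diagonal h → Diagonal (λ a b a′ b′ → h a b (suc a′) (suc b′))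
Diagonal-suc dh a b a′≢b′ = dh a b (a′≢b′ ∘ suc-injective)

diag₂-suc : ∀ n p h → Diagonal h →
            diag₂ (suc n) (suc p) h ≡ diag₂ n p (λ a b a′ b′ → h a b (suc a′) (suc b′)) +ᶻ h (suc n) (suc p) 0 0
diag₂-suc n p h dh = trans (diag-last n (λ a a′ → diag (suc p) (λ b b′ → h a b a′ b′))) (cong₂ _+ᶻ_
  (diag-cong n λ a a′ → trans (diag-last p (λ b b′ → h a b (suc a′) b′)) (trans
    (cong (diag p (λ b b′ → h a b (suc a′) (suc b′)) +ᶻ_) (dh a (suc p) {suc a′} {0} λ ())) (ℤP.+-identityʳ _)))
  (diag-at-0 (suc p) (λ b b′ → h (suc n) b 0 b′) λ b b′ → dh (suc n) b {0} {suc b′} λ ()))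

diag₂-p0 : ∀ n h → Diagonal h → diag₂ n 0 h ≡ h n 0 0 0
diag₂-p0 n h dh = diag-at-0 n (λ a a′ → h a 0 a′ 0) λ a a′ → dh a 0 {suc a′} {0} λ ()

-- The second factor uses up equal amounts of x and y, so the first one keeps the excess `j` of the
-- x-exponent throughout, and a double sum becomes a single one.
diag₂-diagonal : ∀ p j h → Diagonal h → diag₂ (p + j) p h ≡ diag p (λ b b′ → h (b + j) b b′ b′)
diag₂-diagonal zero    j h dh = diag₂-p0 j h dh
diag₂-diagonal (suc p) j h dh = trans (diag₂-suc (p + j) p h dh)
  (trans (cong (_+ᶻ h (suc p + j) (suc p) 0 0)
               (diag₂-diagonal p j (λ a b a′ b′ → h a b (suc a′) (suc b′)) (Diagonal-suc dh)))
         (sym (diag-last p (λ b b′ → h (b + j) b b′ b′))))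

diag₂-above : ∀ n p h → Diagonal h → n < p → (∀ a b a′ b′ → a < b → h a b a′ b′ ≡ 0ℤ) → diag₂ n p h ≡ 0ℤ
diag₂-above zero    p       h dh n<p vanish = trans (diag-at-0 p (λ b b′ → h 0 b 0 b′) λ b b′ → dh 0 b {0} {suc b′} λ ()) (vanish 0 p 0 0 n<p)
diag₂-above (suc n) (suc p) h dh (s≤s n<p) vanish = trans (diag₂-suc n p h dh) (cong₂ _+ᶻ_
  (diag₂-above n p _ (Diagonal-suc dh) n<p (λ a b a′ b′ → vanish a b (suc a′) (suc b′)))
  (vanish (suc n) (suc p) 0 0 (s≤s n<p)))

-- Here `m` entries precede the maximum and `j` follow it; `j` is also the final height of the path.
J-e : ∀ m j l → J (suc (m + j)) (suc m) (suc l) ≡ ofℕ (betaCount j) *ᶻ e m j l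
J-e m j l = trans (J-suc (m + j) m l)
  (trans (cong (λ k → ofℕ (betaCount k * F m (m + j) 0 l)) (m+n∸m≡n m j)) (ℤP.pos-* (betaCount j) _))

B-e : ∀ m l → B (suc m) (suc m) (suc l) ≡ e m 0 l
B-e m l = trans (B-diagonal (suc m) (suc l))
  (trans (cong (λ k → J (suc k) (suc m) (suc l)) (sym (+-identityʳ m))) (trans (J-e m 0 l) (ℤP.*-identityˡ _)))

J-above : ∀ {n p} l → n < p → J n p l ≡ 0ℤ
J-above {zero}          l       n<p       = refl
J-above {suc n} {p}     zero    n<p       = J-lmax0 (suc n) p
J-above {suc n} {suc p} (suc l) (s≤s n<p) = trans (J-suc n p l)
  (cong ofℕ (trans (cong (betaCount (n ∸ p) *_) (F-too-long p n 0 l (subst (_< p) (sym (+-identityʳ n)) n<p))) (*-zeroʳ (betaCount (n ∸ p)))))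

xyw-divisible-J : xyw-Divisible J
xyw-divisible-J = record { n0 = λ _ _ → refl ; p0 = J-pos0 ; l0 = J-lmax0 }

xyw-divisible-B : xyw-Divisible B
xyw-divisible-B = record { n0 = λ _ _ → refl ; p0 = p0 ; l0 = l0 }
  where
  p0 : ∀ n l → B n 0 l ≡ 0ℤ
  p0 zero    l = refl
  p0 (suc n) l = B-off-diagonal (suc n) 0 l λ ()
  l0 : ∀ n p → B n p 0 ≡ 0ℤ
  l0 n p with n ≟ p
  ... | yes refl = trans (B-diagonal n 0) (J-lmax0 n n)
  ... | no n≢p   = B-off-diagonal n p 0 n≢p

B-factor : ∀ (G : FPS3) l → Diagonal (λ a b a′ b′ → diag l (λ c c′ → G (suc a) (suc b) (suc c) *ᶻ B (suc a′) (suc b′) (suc c′)))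
B-factor G l a b {a′} {b′} a′≢b′ = diag-0 l λ c c′ →
  zero-*ʳ (G (suc a) (suc b) (suc c)) (B-off-diagonal (suc a′) (suc b′) (suc c′) (a′≢b′ ∘ suc-injective))

-- B is C up to the monomial xyw, so multiplying by it raises C^(j+1) to C^(j+2) and leaves the
-- factor for β alone.
JB-coefficient : ∀ p j l → (J ⊛ B) (suc (suc (p + j))) (suc (suc p)) (suc (suc l)) ≡ ofℕ (betaCount j) *ᶻ e p (suc j) l
JB-coefficient p j l = begin
  (J ⊛ B) (suc (suc (p + j))) (suc (suc p)) (suc (suc l))
    ≡⟨ ⊛-shift xyw-divisible-J xyw-divisible-B (p + j) p l ⟩
  diag₃ (p + j) p l (λ a b c a′ b′ c′ → J (suc a) (suc b) (suc c) *ᶻ B (suc a′) (suc b′) (suc c′))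
    ≡⟨ diag₂-diagonal p j _ (B-factor J l) ⟩
  diag p (λ b b′ → diag l (λ c c′ → J (suc (b + j)) (suc b) (suc c) *ᶻ B (suc b′) (suc b′) (suc c′)))
    ≡⟨ diag-cong p (λ b b′ → trans
         (diag-cong l λ c c′ → trans (cong₂ _*ᶻ_ (J-e b j c) (B-e b′ c′)) (ℤP.*-assoc (ofℕ (betaCount j)) (e b j c) (e b′ 0 c′)))
         (diag-*ˡ l (ofℕ (betaCount j)) (λ c c′ → e b j c *ᶻ e b′ 0 c′))) ⟩
  diag p (λ b b′ → ofℕ (betaCount j) *ᶻ (e b j ⋆ e b′ 0) l)
    ≡⟨ diag-*ˡ p (ofℕ (betaCount j)) (λ b b′ → (e b j ⋆ e b′ 0) l) ⟩
  ofℕ (betaCount j) *ᶻ conv p j l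
    ≡⟨ cong (ofℕ (betaCount j) *ᶻ_) (e-convolution p j l) ⟩
  ofℕ (betaCount j) *ᶻ e p (suc j) l ∎
  where open ≡-Reasoning

-- Both factors have equal exponents of x and y, which leaves only `j = 0`. Writing the value with
-- `δ j` matches the form in which `betaCount-suc` delivers the other side.
BB-coefficient : ∀ p j l → (B ⊛ B) (suc (suc (p + j))) (suc (suc p)) (suc (suc l)) ≡ ofℕ (δ j) *ᶻ e p (suc j) l
BB-coefficient p j l = trans (⊛-shift xyw-divisible-B xyw-divisible-B (p + j) p l)
  (trans (diag₂-diagonal p j _ (B-factor B l)) (on-diagonal j))
  where
  on-diagonal : ∀ j → diag p (λ b b′ → diag l (λ c c′ → B (suc (b + j)) (suc b) (suc c) *ᶻ B (suc b′) (suc b′) (suc c′)))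
                      ≡ ofℕ (δ j) *ᶻ e p (suc j) l
  on-diagonal zero = begin
    diag p (λ b b′ → diag l (λ c c′ → B (suc (b + 0)) (suc b) (suc c) *ᶻ B (suc b′) (suc b′) (suc c′)))
      ≡⟨ diag-cong p (λ b b′ → diag-cong l λ c c′ →
           cong₂ _*ᶻ_ (trans (cong (λ k → B (suc k) (suc b) (suc c)) (+-identityʳ b)) (B-e b c)) (B-e b′ c′)) ⟩
    conv p 0 l
      ≡⟨ e-convolution p 0 l ⟩
    e p 1 l
      ≡⟨ ℤP.*-identityˡ (e p 1 l) ⟨
    1ℤ *ᶻ e p 1 l ∎
    where open ≡-Reasoning
  on-diagonal (suc j) = diag-0 p λ b b′ → diag-0 l λ c c′ → zero-*ˡ (B (suc b′) (suc b′) (suc c′))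
    (B-off-diagonal (suc (b + suc j)) (suc b) (suc c) (m+1+n≢m b ∘ suc-injective))

above-coefficient : ∀ {G} → xyw-Divisible G → (∀ {n p} l → n < p → G n p l ≡ 0ℤ) → ∀ n p l → n < p →
                    (G ⊛ B) (suc (suc n)) (suc (suc p)) (suc (suc l)) ≡ 0ℤ
above-coefficient {G} dG above n p l n<p = trans (⊛-shift dG xyw-divisible-B n p l)
  (diag₂-above n p _ (B-factor G l) n<p λ a b a′ b′ a<b →
    diag-0 l λ c c′ → zero-*ˡ (B (suc a′) (suc b′) (suc c′)) (above (suc c) (s≤s a<b)))

-- At `j = 0` this is 2 · 1 - 1 = 1; from `j = 1` on each factor is twice the one before.
betaCount-suc : ∀ j → ofℕ (betaCount j) +ᶻ ofℕ (betaCount j) ⊟ ofℕ (betaCount (suc j)) ≡ ofℕ (δ j)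
betaCount-suc zero    = refl
betaCount-suc (suc j) = trans (cong (λ x → ofℕ (2 ^ j) +ᶻ ofℕ (2 ^ j) ⊟ x) (ℤP.pos-* 2 (2 ^ j))) (cancel (ofℕ (2 ^ j)))
  where
  cancel : ∀ x → x +ᶻ x ⊟ ofℕ 2 *ᶻ x ≡ 0ℤ
  cancel = ℤS.solve-∀

J≡B : ∀ {n p} l → n ≤ p → J n p l ≡ B n p l
J≡B {n} {p} l n≤p with n ≟ p
... | yes refl = sym (B-diagonal n l)
... | no n≢p   = trans (J-above l (≤∧≢⇒< n≤p n≢p)) (sym (B-off-diagonal n p l n≢p))

equal-difference : ∀ {x y z w} → x ≡ 0ℤ → y ≡ 0ℤ → z ≡ w → x +ᶻ x ⊟ z ≡ y ⊟ w
equal-difference refl refl refl = refl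

-- The equation with the multiplications by yw carried out, which lowers two indices of J and B.
-- Where both products vanish it says that J and B agree; elsewhere the excess of `n` over `p`
-- decides.
reduced : ∀ n p l → (J ⊛ B) n (suc p) (suc l) +ᶻ (J ⊛ B) n (suc p) (suc l) ⊟ J n p l
                    ≡ (B ⊛ B) n (suc p) (suc l) ⊟ B n p l
reduced zero p l = equal-difference (vanish J (λ _ _ → refl)) (vanish B (λ _ _ → refl)) (refl {x = 0ℤ})
  where
  vanish : ∀ G → (∀ p l → G 0 p l ≡ 0ℤ) → (G ⊛ B) 0 (suc p) (suc l) ≡ 0ℤ
  vanish G g = trans (⊛-diag₃ G B 0 (suc p) (suc l))
    (diag-0 (suc p) λ b b′ → diag-0 (suc l) λ c c′ → zero-*ʳ (G 0 b c) refl)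
reduced (suc zero) zero l = equal-difference (⊛-n1 xyw-divisible-J xyw-divisible-B 1 (suc l)) (⊛-n1 xyw-divisible-B xyw-divisible-B 1 (suc l))
  (trans (J-pos0 1 l) (sym (xyw-Divisible.p0 xyw-divisible-B 1 l)))
reduced (suc zero) (suc p) l =
  equal-difference (⊛-n1 xyw-divisible-J xyw-divisible-B (suc (suc p)) (suc l)) (⊛-n1 xyw-divisible-B xyw-divisible-B (suc (suc p)) (suc l)) (J≡B {1} {suc p} l (s≤s z≤n))
reduced n@(suc (suc _)) zero l = equal-difference (⊛-p1 xyw-divisible-J xyw-divisible-B n (suc l)) (⊛-p1 xyw-divisible-B xyw-divisible-B n (suc l))
  (trans (J-pos0 n l) (sym (xyw-Divisible.p0 xyw-divisible-B n l)))
reduced n@(suc (suc _)) p@(suc _) zero = equal-difference (⊛-l1 xyw-divisible-J xyw-divisible-B n (suc p)) (⊛-l1 xyw-divisible-B xyw-divisible-B n (suc p))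
  (trans (J-lmax0 n p) (sym (xyw-Divisible.l0 xyw-divisible-B n p)))
reduced (suc (suc n)) (suc p) (suc l) with p ≤? n
... | no p≰n = equal-difference (above-coefficient xyw-divisible-J J-above n p l (≰⇒> p≰n))
                 (above-coefficient xyw-divisible-B (λ {n} {p} l n<p → B-off-diagonal n p l (<⇒≢ n<p)) n p l (≰⇒> p≰n))
                 (J≡B (suc l) (s≤s (≰⇒> p≰n)))
-- In `J N (suc p)` the maximum is followed by `suc j` entries, one more than in the J-factor of the
-- product, whose second factor B adds one power of C. So every nonzero term is a multiple of the
-- same `E`, and `B N (suc p)` is 0 because `N` exceeds `suc p`.
... | yes p≤n with j , refl ← m≤n⇒∃[o]m+o≡n p≤n = begin
  (J ⊛ B) N P L +ᶻ (J ⊛ B) N P L ⊟ J N (suc p) (suc l)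
    ≡⟨ cong₂ _⊟_ (cong₂ _+ᶻ_ (JB-coefficient p j l) (JB-coefficient p j l))
         (trans (cong (λ k → J (suc k) (suc p) (suc l)) (sym (+-suc p j))) (J-e p (suc j) l)) ⟩
  ofℕ (betaCount j) *ᶻ E +ᶻ ofℕ (betaCount j) *ᶻ E ⊟ ofℕ (betaCount (suc j)) *ᶻ E
    ≡⟨ factor (ofℕ (betaCount j)) (ofℕ (betaCount (suc j))) E ⟩
  (ofℕ (betaCount j) +ᶻ ofℕ (betaCount j) ⊟ ofℕ (betaCount (suc j))) *ᶻ E
    ≡⟨ cong (_*ᶻ E) (betaCount-suc j) ⟩
  ofℕ (δ j) *ᶻ E
    ≡⟨ ℤP.+-identityʳ _ ⟨
  ofℕ (δ j) *ᶻ E ⊟ 0ℤ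
    ≡⟨ cong₂ _⊟_ (BB-coefficient p j l) (B-off-diagonal N (suc p) (suc l) (m+1+n≢m p ∘ suc-injective ∘ trans (cong suc (+-suc p j)))) ⟨
  (B ⊛ B) N P L ⊟ B N (suc p) (suc l) ∎
  where
  open ≡-Reasoning
  N = suc (suc (p + j))
  P = suc (suc p)
  L = suc (suc l)
  E = e p (suc j) l
  factor : ∀ x y z → x *ᶻ z +ᶻ x *ᶻ z ⊟ y *ᶻ z ≡ (x +ᶻ x ⊟ y) *ᶻ z
  factor = ℤS.solve-∀

-- The quotient is read with its denominator cleared: 2B - yw has constant term 0 and hence no
-- inverse power series. It is nonzero, its coefficient at yw being -1, and integer power series
-- form a domain, so the equation determines J.
theorem10 : (n p l : ℕ) → (J ⊛ ((B ⊕ B) ⊖ yw)) n p l ≡ (B ⊛ (B ⊖ yw)) n p l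
theorem10 n p l = begin
  (J ⊛ ((B ⊕ B) ⊖ yw)) n p l
    ≡⟨ ⊛-distribˡ-⊖ J (B ⊕ B) yw n p l ⟩
  (J ⊛ (B ⊕ B)) n p l ⊟ (J ⊛ yw) n p l
    ≡⟨ cong (_⊟ (J ⊛ yw) n p l) (⊛-distribˡ-⊕ J B B n p l) ⟩
  (J ⊛ B) n p l +ᶻ (J ⊛ B) n p l ⊟ (J ⊛ yw) n p l
    ≡⟨ coefficient p l ⟩
  (B ⊛ B) n p l ⊟ (B ⊛ yw) n p l
    ≡⟨ ⊛-distribˡ-⊖ B B yw n p l ⟨
  (B ⊛ (B ⊖ yw)) n p l ∎
  where
  open ≡-Reasoning
  open xyw-Divisible xyw-divisible-B using (p0; l0)
  coefficient : ∀ p l → (J ⊛ B) n p l +ᶻ (J ⊛ B) n p l ⊟ (J ⊛ yw) n p l ≡ (B ⊛ B) n p l ⊟ (B ⊛ yw) n p l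
  coefficient zero    l       = equal-difference (⊛-pos0 J B n l p0) (⊛-pos0 B B n l p0)
    (trans (⊛-pos0 J yw n l yw-pos0) (sym (⊛-pos0 B yw n l yw-pos0)))
  coefficient (suc p) zero    = equal-difference (⊛-lmax0 J B n (suc p) l0) (⊛-lmax0 B B n (suc p) l0)
    (trans (⊛-lmax0 J yw n (suc p) yw-lmax0) (sym (⊛-lmax0 B yw n (suc p) yw-lmax0)))
  coefficient (suc p) (suc l) = trans
    (cong ((J ⊛ B) n (suc p) (suc l) +ᶻ (J ⊛ B) n (suc p) (suc l) ⊟_) (⊛-yw J n p l))
    (trans (reduced n p l) (cong ((B ⊛ B) n (suc p) (suc l) ⊟_) (sym (⊛-yw B n p l))))
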